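{- For all integers $n,k \geq 2$ there exists a set $S \subset \mathbb{R}^2$ such that any $k$ points of $S$ are visible from a common point of $S$ through polygonal paths of length $\leq n$ in $S$, but there exist $k+1$ points of $S$ that are not visible from any common point of $S$ through polygonal paths of length $\leq n$ in $S$.
   Context: For $S \subset \mathbb{R}^2$ and $x,y \in S$, "$x$ sees $y$ through $S$ by a polygonal path of length $m$" means there exist distinct points $x_1,\ldots,x_{m-1}$ such that the polygonal path $[x,x_1]\cup[x_1,x_2]\cup\cdots\cup[x_{m-1},y]$ is contained in $S$ (for $m=1$ this means $[x,y]\subset S$). "Visible through polygonal paths of length $\leq n$" means visible by such a path of some length $m \leq n$. -}

module Defs where

open import Algebra.Bundles using (CommutativeRing)
import Algebra.Properties.CommutativeSemigroup
import Algebra.Properties.Ring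
open import Level using (0ℓ)
open import Data.Nat.Base as ℕ using (ℕ; _⊔_)
import Data.Nat.Properties as ℕ
open import Data.Rational.Base as ℚ using (ℚ; 0ℚ; 1ℚ; ½; ∣_∣; 1/_; Positive)
import Data.Rational.Properties as ℚ
open import Data.Product.Base using (Σ-syntax; ∃-syntax; _×_; _,_)
open import Data.Product.Relation.Binary.Pointwise.NonDependent using (_×ₛ_)
open import Data.Fin.Base using (Fin)
open import Data.Vec.Base using (Vec; []; _∷_)
import Relation.Binary.Reasoning.Setoid as SetoidReasoning
import Data.Vec.Relation.Unary.Unique.Setoid as UniqueSetoid
open import Relation.Binary.Bundles using (Setoid)
open import Relation.Binary.Definitions using (Reflexive; Symmetric; Transitive)
open import Relation.Binary.PropositionalEquality
  using (_≡_; sym; trans; cong; subst)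
open import Relation.Unary using (Pred; _∈_; _⊆_; _∪_)

private
  -- Proved for an abstract ring: conversion checking over ℚ itself would
  -- unfold the arithmetic of normalised fractions.
  module Identities (R : CommutativeRing 0ℓ 0ℓ) where
    open CommutativeRing R hiding (sym; trans)
    open Algebra.Properties.Ring ring
    open Algebra.Properties.CommutativeSemigroup +-commutativeSemigroup using (interchange)
    open SetoidReasoning setoid

    telescope : ∀ p q r → p - r ≈ (p - q) + (q - r)
    telescope p q r = begin
      p - r                   ≈⟨ +-congˡ (+-identityˡ (- r)) ⟨
      p + (0# - r)            ≈⟨ +-congˡ (+-congʳ (-‿inverseˡ q)) ⟨
      p + ((- q + q) - r)     ≈⟨ +-congˡ (+-assoc (- q) q (- r)) ⟩
      p + (- q + (q - r))     ≈⟨ +-assoc p (- q) (q - r) ⟨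
      (p - q) + (q - r)       ∎

    add-sub : ∀ p q r s → (p + q) - (r + s) ≈ (p - r) + (q - s)
    add-sub p q r s = begin
      (p + q) - (r + s)        ≈⟨ +-congˡ (-‿+-comm r s) ⟨
      (p + q) + (- r + - s)    ≈⟨ interchange p q (- r) (- s) ⟩
      (p - r) + (q - s)        ∎

    mul-sub : ∀ p q r s → p * q - r * s ≈ p * (q - s) + s * (p - r)
    mul-sub p q r s = begin
      p * q - r * s                          ≈⟨ telescope (p * q) (p * s) (r * s) ⟩
      (p * q - p * s) + (p * s - r * s)      ≈⟨ +-cong (x[y-z]≈xy-xz p q s) ([y-z]x≈yx-zx s p r) ⟨
      p * (q - s) + (p - r) * s              ≈⟨ +-congˡ (*-comm (p - r) s) ⟩
      p * (q - s) + s * (p - r)              ∎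

    neg-sub : ∀ p q → - (p - q) ≈ - p - (- q)
    neg-sub p q = CommutativeRing.sym R (-‿+-comm p (- q))

    flip-sub : ∀ p q → - (p - q) ≈ q - p
    flip-sub = ⁻¹-anti-homo‿-

    recover : ∀ p q → p ≈ q + (p - q)
    recover p q = begin
      p               ≈⟨ +-identityʳ p ⟨
      p + 0#          ≈⟨ +-congˡ (-‿inverseʳ q) ⟨
      p + (q - q)     ≈⟨ +-assoc p q (- q) ⟨
      (p + q) - q     ≈⟨ +-congʳ (+-comm p q) ⟩
      (q + p) - q     ≈⟨ +-assoc q p (- q) ⟩
      q + (p - q)     ∎

------------------------------------------------------------------------
-- Real numbers: Cauchy sequences of rationals, compared up to _≈_.

record ℝ : Set where
  constructor mkℝ
  field
    seq    : ℕ → ℚ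
    cauchy : ∀ ε → 0ℚ ℚ.< ε →
             ∃[ N ] (∀ m n → N ℕ.≤ m → N ℕ.≤ n → ∣ seq m ℚ.- seq n ∣ ℚ.< ε)

open ℝ public

infix 4 _≈_ _≤_

_≈_ : ℝ → ℝ → Set
x ≈ y = ∀ ε → 0ℚ ℚ.< ε → ∃[ N ] (∀ n → N ℕ.≤ n → ∣ seq x n ℚ.- seq y n ∣ ℚ.< ε)

_≤_ : ℝ → ℝ → Set
x ≤ y = ∀ ε → 0ℚ ℚ.< ε → ∃[ N ] (∀ n → N ℕ.≤ n → seq x n ℚ.< seq y n ℚ.+ ε)

private
  open Identities ℚ.+-*-commutativeRing
  open ℚ.≤-Reasoning

  half>0 : ∀ {ε} → 0ℚ ℚ.< ε → 0ℚ ℚ.< ½ ℚ.* ε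
  half>0 {ε} ε>0 = ℚ.positive⁻¹ _ {{ℚ.pos*pos⇒pos ½ ε {{ℚ.positive ε>0}}}}

  halves : ∀ ε → ½ ℚ.* ε ℚ.+ ½ ℚ.* ε ≡ ε
  halves ε = trans (sym (ℚ.*-distribʳ-+ ε ½ ½)) (ℚ.*-identityˡ ε)

  -- An ε/2 argument.
  sum<ε : ∀ {p q r ε} → r ≡ p ℚ.+ q →
          ∣ p ∣ ℚ.< ½ ℚ.* ε → ∣ q ∣ ℚ.< ½ ℚ.* ε → ∣ r ∣ ℚ.< ε
  sum<ε {p} {q} {r} {ε} r≡p+q p< q< = begin-strict
    ∣ r ∣                   ≡⟨ cong ∣_∣ r≡p+q ⟩
    ∣ p ℚ.+ q ∣             ≤⟨ ℚ.∣p+q∣≤∣p∣+∣q∣ p q ⟩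
    ∣ p ∣ ℚ.+ ∣ q ∣         <⟨ ℚ.+-mono-< p< q< ⟩
    ½ ℚ.* ε ℚ.+ ½ ℚ.* ε     ≡⟨ halves ε ⟩
    ε                       ∎

  swap : ∀ p q → ∣ p ℚ.- q ∣ ≡ ∣ q ℚ.- p ∣
  swap p q = trans (sym (ℚ.∣-p∣≡∣p∣ (p ℚ.- q))) (cong ∣_∣ (flip-sub p q))

  ≤⊔ˡ : ∀ {M N n} → M ⊔ N ℕ.≤ n → M ℕ.≤ n
  ≤⊔ˡ = ℕ.m⊔n≤o⇒m≤o _ _

  ≤⊔ʳ : ∀ {M N n} → M ⊔ N ℕ.≤ n → N ℕ.≤ n
  ≤⊔ʳ = ℕ.m⊔n≤o⇒n≤o _ _

≈-refl : Reflexive _≈_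
≈-refl {x} ε ε>0 =
  0 , λ n _ → subst (λ r → ∣ r ∣ ℚ.< ε) (sym (ℚ.+-inverseʳ (seq x n))) ε>0

≈-sym : Symmetric _≈_
≈-sym {x} {y} x≈y ε ε>0 with x≈y ε ε>0
... | N , h = N , λ n N≤n → subst (ℚ._< ε) (swap (seq x n) (seq y n)) (h n N≤n)

≈-trans : Transitive _≈_
≈-trans {x} {y} {z} x≈y y≈z ε ε>0 with x≈y _ (half>0 ε>0) | y≈z _ (half>0 ε>0)
... | M , h | N , k = M ⊔ N , λ n b → sum<ε
  (telescope (seq x n) (seq y n) (seq z n))
  (h n (≤⊔ˡ b)) (k n (≤⊔ʳ b))

ℝ-setoid : Setoid 0ℓ 0ℓ
ℝ-setoid = record
  { Carrier       = ℝ
  ; _≈_           = _≈_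
  ; isEquivalence = record
    { refl  = λ {x} → ≈-refl {x}
    ; sym   = λ {x} {y} → ≈-sym {x} {y}
    ; trans = λ {x} {y} {z} → ≈-trans {x} {y} {z}
    }
  }

fromℚ : ℚ → ℝ
fromℚ q = mkℝ (λ _ → q) λ ε ε>0 →
  0 , λ _ _ _ _ → subst (λ r → ∣ r ∣ ℚ.< ε) (sym (ℚ.+-inverseʳ q)) ε>0

0ℝ 1ℝ : ℝ
0ℝ = fromℚ 0ℚ
1ℝ = fromℚ 1ℚ

private
  +-cauchy : ∀ x y ε → 0ℚ ℚ.< ε → ∃[ N ] (∀ m n → N ℕ.≤ m → N ℕ.≤ n →
    ∣ (seq x m ℚ.+ seq y m) ℚ.- (seq x n ℚ.+ seq y n) ∣ ℚ.< ε)
  +-cauchy x y ε ε>0 with cauchy x _ (half>0 ε>0) | cauchy y _ (half>0 ε>0)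
  ... | M , h | N , k = M ⊔ N , λ m n a b → sum<ε
    (add-sub (seq x m) (seq y m) (seq x n) (seq y n))
    (h m n (≤⊔ˡ a) (≤⊔ˡ b)) (k m n (≤⊔ʳ a) (≤⊔ʳ b))

  neg-cauchy : ∀ x ε → 0ℚ ℚ.< ε → ∃[ N ] (∀ m n → N ℕ.≤ m → N ℕ.≤ n →
    ∣ (ℚ.- seq x m) ℚ.- (ℚ.- seq x n) ∣ ℚ.< ε)
  neg-cauchy x ε ε>0 with cauchy x ε ε>0
  ... | N , h = N , λ m n a b → subst (ℚ._< ε)
    (trans (sym (ℚ.∣-p∣≡∣p∣ (seq x m ℚ.- seq x n)))
      (cong ∣_∣ (neg-sub (seq x m) (seq x n))))
    (h m n a b)

  bounded : ∀ x → Σ[ B ∈ ℚ ] (Positive B × ∃[ N ] (∀ n → N ℕ.≤ n → ∣ seq x n ∣ ℚ.≤ B))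
  bounded x with cauchy x 1ℚ (ℚ.positive⁻¹ 1ℚ)
  ... | N , h = ∣ seq x N ∣ ℚ.+ 1ℚ
              , ℚ.nonNeg+pos⇒pos ∣ seq x N ∣ {{ℚ.nonNegative (ℚ.0≤∣p∣ (seq x N))}} 1ℚ
              , N , λ n N≤n → begin
    ∣ seq x n ∣
      ≡⟨ cong ∣_∣ (recover (seq x n) (seq x N)) ⟩
    ∣ seq x N ℚ.+ (seq x n ℚ.- seq x N) ∣
      ≤⟨ ℚ.∣p+q∣≤∣p∣+∣q∣ (seq x N) (seq x n ℚ.- seq x N) ⟩
    ∣ seq x N ∣ ℚ.+ ∣ seq x n ℚ.- seq x N ∣
      ≤⟨ ℚ.+-monoʳ-≤ ∣ seq x N ∣ (ℚ.<⇒≤ (h n N N≤n ℕ.≤-refl)) ⟩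
    ∣ seq x N ∣ ℚ.+ 1ℚ ∎

  -- ∣ p ∣ ≤ B and ∣ d ∣ < ε/(2B) give ∣ p d ∣ < ε/2.
  module _ (B : ℚ) (B>0 : Positive B) (ε : ℚ) (ε>0 : 0ℚ ℚ.< ε) where
    private instance
      B-pos     = B>0
      B-nonZero = ℚ.pos⇒nonZero B {{B>0}}
      1/B-pos   = ℚ.1/pos⇒pos B {{B>0}}

    scaled : ℚ
    scaled = (1/ B) ℚ.* (½ ℚ.* ε)

    scaled>0 : 0ℚ ℚ.< scaled
    scaled>0 = ℚ.positive⁻¹ _
      {{ℚ.pos*pos⇒pos (1/ B) (½ ℚ.* ε) {{ℚ.positive (half>0 ε>0)}}}}

    product<ε/2 : ∀ {p d} → ∣ p ∣ ℚ.≤ B → ∣ d ∣ ℚ.< scaled → ∣ p ℚ.* d ∣ ℚ.< ½ ℚ.* ε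
    product<ε/2 {p} {d} p≤ d< = begin-strict
      ∣ p ℚ.* d ∣         ≡⟨ ℚ.∣p*q∣≡∣p∣*∣q∣ p d ⟩
      ∣ p ∣ ℚ.* ∣ d ∣     ≤⟨ ℚ.*-monoʳ-≤-nonNeg ∣ d ∣ {{ℚ.nonNegative (ℚ.0≤∣p∣ d)}} p≤ ⟩
      B ℚ.* ∣ d ∣         <⟨ ℚ.*-monoʳ-<-pos B d< ⟩
      B ℚ.* scaled        ≡⟨ sym (ℚ.*-assoc B (1/ B) (½ ℚ.* ε)) ⟩
      (B ℚ.* 1/ B) ℚ.* (½ ℚ.* ε)  ≡⟨ cong (ℚ._* (½ ℚ.* ε)) (ℚ.*-inverseʳ B) ⟩
      1ℚ ℚ.* (½ ℚ.* ε)    ≡⟨ ℚ.*-identityˡ (½ ℚ.* ε) ⟩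
      ½ ℚ.* ε             ∎

  *-cauchy : ∀ x y ε → 0ℚ ℚ.< ε → ∃[ N ] (∀ m n → N ℕ.≤ m → N ℕ.≤ n →
    ∣ (seq x m ℚ.* seq y m) ℚ.- (seq x n ℚ.* seq y n) ∣ ℚ.< ε)
  *-cauchy x y ε ε>0 with bounded x | bounded y
  ... | A , A>0 , K , xb | B , B>0 , L , yb
    with cauchy x (scaled B B>0 ε ε>0) (scaled>0 B B>0 ε ε>0)
       | cauchy y (scaled A A>0 ε ε>0) (scaled>0 A A>0 ε ε>0)
  ... | M , h | N , k = (K ⊔ L) ⊔ (M ⊔ N) , λ m n a b → sum<ε
    (mul-sub (seq x m) (seq y m) (seq x n) (seq y n))
    (product<ε/2 A A>0 ε ε>0 {seq x m} (xb m (≤⊔ˡ (≤⊔ˡ a)))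
      (k m n (≤⊔ʳ {M} (≤⊔ʳ {K ⊔ L} a)) (≤⊔ʳ {M} (≤⊔ʳ {K ⊔ L} b))))
    (product<ε/2 B B>0 ε ε>0 {seq y n} (yb n (≤⊔ʳ {K} (≤⊔ˡ b)))
      (h m n (≤⊔ˡ (≤⊔ʳ {K ⊔ L} a)) (≤⊔ˡ (≤⊔ʳ {K ⊔ L} b))))

infixl 6 _+_ _-_
infixl 7 _*_
infix  8 -_

_+_ _*_ : ℝ → ℝ → ℝ
x + y = mkℝ (λ n → seq x n ℚ.+ seq y n) (+-cauchy x y)
x * y = mkℝ (λ n → seq x n ℚ.* seq y n) (*-cauchy x y)

-_ : ℝ → ℝ
- x = mkℝ (λ n → ℚ.- seq x n) (neg-cauchy x)

_-_ : ℝ → ℝ → ℝ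
x - y = x + (- y)

------------------------------------------------------------------------
-- The plane

ℝ²-setoid : Setoid 0ℓ 0ℓ
ℝ²-setoid = ℝ-setoid ×ₛ ℝ-setoid

open Setoid ℝ²-setoid public using () renaming (Carrier to ℝ²; _≈_ to _≈²_)
open UniqueSetoid ℝ²-setoid public using (Unique)

[_⟷_] : ℝ² → ℝ² → Pred ℝ² 0ℓ
[ (a₁ , a₂) ⟷ (b₁ , b₂) ] z =
  ∃[ t ] 0ℝ ≤ t × t ≤ 1ℝ ×
         z ≈² ((1ℝ - t) * a₁ + t * b₁ , (1ℝ - t) * a₂ + t * b₂)

------------------------------------------------------------------------
-- Visibility through polygonal paths

polygonalPath : ∀ {l} → ℝ² → Vec ℝ² l → ℝ² → Pred ℝ² 0ℓ
polygonalPath x []       y = [ x ⟷ y ]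
polygonalPath x (v ∷ vs) y = [ x ⟷ v ] ∪ polygonalPath v vs y

-- A path of length m has m - 1 intermediate points; only these are required
-- to be distinct from one another, not from the end points.
SeesByLength : (m : ℕ) → .{{ℕ.NonZero m}} → Pred ℝ² 0ℓ → ℝ² → ℝ² → Set
SeesByLength m S x y = Σ[ vs ∈ Vec ℝ² (ℕ.pred m) ] (Unique vs × polygonalPath x vs y ⊆ S)

VisibleWithin : ℕ → Pred ℝ² 0ℓ → ℝ² → ℝ² → Set
VisibleWithin n S x y =
  ∃[ m ] Σ[ m≥1 ∈ ℕ.NonZero m ] (m ℕ.≤ n × SeesByLength m {{m≥1}} S x y)

HasCommonViewpoint : ∀ {k} → ℕ → Pred ℝ² 0ℓ → (Fin k → ℝ²) → Set
HasCommonViewpoint n S p = ∃[ c ] (c ∈ S × ∀ i → VisibleWithin n S c (p i))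

{-# OPTIONS --safe #-}
module Submission where

-- S is a union of closed segments.  Vertices c_j = (j , 2j), 0 ≤ j ≤ k, lie on
-- an axis, and from c_j a left leg of slope 1 and a right leg of slope -1 run
-- downwards.  For every i ≤ k, arm i is a polygonal line of n - 1 segments
-- (numbered from 0) starting with a horizontal one.  The horizontal segment of
-- arm i crosses the left leg of c_j for j > i and passes below its end for j ≤
-- i; it crosses the right leg of c_j for j < i and stops before it for j ≥ i.
-- So c_j sees the whole of every arm but arm j within n links, and everything
-- outside the arms within two; given k points, some arm i contains none of
-- them, and c_i sees them all.  The far end q_i of arm i is seen within n links
-- only from arm i and from the legs crossing it.  A point seeing q_0 and q_k is
-- therefore on a left and on a right leg; these meet only at some c_j, which
-- does not see q_j.
--
-- That each link in S stays on one of the segments is proved by looking at the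
-- points of the link near its ends: one of the finitely many segments contains
-- such points arbitrarily close to the end, hence the end itself by closedness.
-- This uses classical reasoning, which is harmless under a negation.

open import Defs
open import Level using (0ℓ)
open import Data.Nat.Base as ℕ using (ℕ; zero; suc) renaming (_≤_ to _≤ℕ_)
import Data.Nat.Properties as ℕ
open import Data.Integer.Base as ℤ using (ℤ; +_; -[1+_]; 0ℤ; 1ℤ; -1ℤ)
import Data.Integer.Properties as ℤ
import Data.Integer.Solver
open import Data.Rational.Base as ℚ using (ℚ; 0ℚ; 1ℚ; ∣_∣; *<*; *≤*)
open import Data.Rational.Literals using () renaming (fromℤ to ι)
import Data.Rational.Properties as ℚ
import Data.Rational.Solver
import Data.Rational.Unnormalised.Base as ℚᵘ
import Data.Rational.Unnormalised.Properties as ℚᵘ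
open import Data.Empty using (⊥)
open import Data.Fin.Base using (Fin; toℕ; fromℕ<)
import Data.Fin.Properties as Fin
open import Data.Product.Base using (Σ-syntax; ∃-syntax; _×_; _,_; proj₁; proj₂)
open import Data.Sum.Base using (_⊎_; inj₁; inj₂)
open import Data.Unit.Base using (⊤; tt)
open import Data.Vec.Base using (Vec; []; _∷_)
open import Data.Vec.Relation.Unary.All using (All; []; _∷_)
open import Data.Vec.Relation.Unary.AllPairs using ([]; _∷_)
open import Function.Definitions using (Injective)
open import Relation.Binary.Definitions using (_Respects_; Tri; tri<; tri≈; tri>)
open import Relation.Binary.PropositionalEquality
  using (_≡_; _≢_; refl; sym; trans; cong; cong₂; subst; subst₂; module ≡-Reasoning)
open import Relation.Nullary.Decidable.Core using (yes; no)
open import Relation.Nullary.Negation using (¬_; contradiction)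
open import Relation.Unary using (Pred; _∈_; _⊆_)

module ℤ-Solver = Data.Integer.Solver.+-*-Solver
module ℚ-Solver = Data.Rational.Solver.+-*-Solver

-- Integers as rationals, and order facts about rationals

ι-+ : ∀ a b → ι (a ℤ.+ b) ≡ ι a ℚ.+ ι b
ι-+ a b = ℚ.toℚᵘ-injective (ℚᵘ.≃-trans
  (ℚᵘ.*≡* (solve 2 (λ x y → (x :+ y) :* con 1ℤ := (x :* con 1ℤ :+ y :* con 1ℤ) :* con 1ℤ) refl a b))
  (ℚᵘ.≃-sym (ℚ.toℚᵘ-homo-+ (ι a) (ι b))))
  where open ℤ-Solver

ι-* : ∀ a b → ι (a ℤ.* b) ≡ ι a ℚ.* ι b
ι-* a b = ℚ.toℚᵘ-injective (ℚᵘ.≃-trans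
  (ℚᵘ.*≡* refl)
  (ℚᵘ.≃-sym (ℚ.toℚᵘ-homo-* (ι a) (ι b))))

ι-neg : ∀ a → ι (ℤ.- a) ≡ ℚ.- ι a
ι-neg a = ℚ.toℚᵘ-injective (ℚᵘ.≃-trans
  (ℚᵘ.*≡* refl)
  (ℚᵘ.≃-sym (ℚ.toℚᵘ-homo‿- (ι a))))

ι-mono-≤ : ∀ {a b} → a ℤ.≤ b → ι a ℚ.≤ ι b
ι-mono-≤ a≤b = *≤* (ℤ.*-monoʳ-≤-nonNeg 1ℤ a≤b)

ι-cancel-≤ : ∀ {a b} → ι a ℚ.≤ ι b → a ℤ.≤ b
ι-cancel-≤ (*≤* p) = ℤ.*-cancelʳ-≤-pos _ _ 1ℤ p

archimedean : ∀ q → ∃[ K ] q ℚ.< ι (+ suc K)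
archimedean q@(ℚ.mkℚ n d-1 _) = ℤ.∣ n ∣ , *<* (begin-strict
  n ℤ.* 1ℤ                        ≡⟨ ℤ.*-identityʳ n ⟩
  n                               ≤⟨ i≤∣i∣ n ⟩
  + ℤ.∣ n ∣                       <⟨ ℤ.+<+ (ℕ.n<1+n ℤ.∣ n ∣) ⟩
  + suc ℤ.∣ n ∣                   ≤⟨ ℤ.+≤+ (ℕ.m≤m*n (suc ℤ.∣ n ∣) (suc d-1)) ⟩
  + (suc ℤ.∣ n ∣ ℕ.* suc d-1)     ≡⟨ ℤ.pos-* (suc ℤ.∣ n ∣) (suc d-1) ⟩
  + suc ℤ.∣ n ∣ ℤ.* + suc d-1     ∎)
  where
  open ℤ.≤-Reasoning
  i≤∣i∣ : ∀ i → i ℤ.≤ + ℤ.∣ i ∣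
  i≤∣i∣ (+ _)    = ℤ.≤-refl
  i≤∣i∣ -[1+ _ ] = ℤ.-≤+

p≤∣p∣ : ∀ p → p ℚ.≤ ∣ p ∣
p≤∣p∣ p with ℚ.≤-total 0ℚ p
... | inj₁ 0≤p = ℚ.≤-reflexive (sym (ℚ.0≤p⇒∣p∣≡p 0≤p))
... | inj₂ p≤0 = ℚ.≤-trans p≤0 (ℚ.0≤∣p∣ p)

0<-+ : ∀ {p q} → 0ℚ ℚ.< p → 0ℚ ℚ.< q → 0ℚ ℚ.< p ℚ.+ q
0<-+ = ℚ.+-mono-<

0<-* : ∀ {p q} → 0ℚ ℚ.< p → 0ℚ ℚ.< q → 0ℚ ℚ.< p ℚ.* q
0<-* {p} {q} 0<p 0<q =
  ℚ.positive⁻¹ _ {{ℚ.pos*pos⇒pos p {{ℚ.positive 0<p}} q {{ℚ.positive 0<q}}}}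

p<q⇒0<q-p : ∀ {p q} → p ℚ.< q → 0ℚ ℚ.< q ℚ.- p
p<q⇒0<q-p {p} {q} p<q =
  subst (ℚ._< q ℚ.- p) (ℚ.+-inverseʳ p) (ℚ.+-monoˡ-< (ℚ.- p) p<q)

0<ι[1+n] : ∀ n → 0ℚ ℚ.< ι (+ suc n)
0<ι[1+n] n = ℚ.positive⁻¹ _

divide : ∀ ε → 0ℚ ℚ.< ε → ∀ K → ∃[ δ ] (0ℚ ℚ.< δ × ι (+ suc K) ℚ.* δ ≡ ε)
divide ε ε>0 K = r ℚ.* ε , 0<-* (ℚ.positive⁻¹ r {{ℚ.1/pos⇒pos k}}) ε>0 , (begin
  k ℚ.* (r ℚ.* ε)   ≡⟨ ℚ.*-assoc k r ε ⟨
  k ℚ.* r ℚ.* ε     ≡⟨ cong (ℚ._* ε) (ℚ.*-inverseʳ k) ⟩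
  1ℚ ℚ.* ε          ≡⟨ ℚ.*-identityˡ ε ⟩
  ε                 ∎)
  where
  open ≡-Reasoning
  k r : ℚ
  k = ι (+ suc K)
  r = ℚ.1/ k

halve : ∀ ε → 0ℚ ℚ.< ε → ∃[ δ ] (0ℚ ℚ.< δ × δ ℚ.+ δ ≡ ε)
halve ε ε>0 with divide ε ε>0 1
... | δ , δ>0 , eq = δ , δ>0 ,
  trans (solve 1 (λ d → d :+ d := con (ι (+ 2)) :* d) refl δ) eq
  where open ℚ-Solver

-- Cauchy reals

≗⇒≈ : ∀ x y → (∀ n → seq x n ≡ seq y n) → x ≈ y
≗⇒≈ x y x≗y ε ε>0 = 0 , λ n _ →
  subst (λ q → ∣ q ∣ ℚ.< ε)
    (sym (trans (cong (ℚ._- seq y n) (x≗y n)) (ℚ.+-inverseʳ (seq y n)))) ε>0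

0≤-≗ : ∀ x y → (∀ n → seq x n ≡ seq y n) → 0ℝ ≤ x → 0ℝ ≤ y
0≤-≗ x y x≗y 0≤x ε ε>0 with 0≤x ε ε>0
... | N , h = N , λ n N≤n → subst (λ q → 0ℚ ℚ.< q ℚ.+ ε) (x≗y n) (h n N≤n)

0≤-resp-≈ : ∀ x y → x ≈ y → 0ℝ ≤ x → 0ℝ ≤ y
0≤-resp-≈ x y x≈y 0≤x ε ε>0 =
  let δ , δ>0 , δ+δ≡ε = halve ε ε>0
      M , h = 0≤x δ δ>0
      N , k = x≈y δ δ>0
  in M ℕ.⊔ N , λ n b → subst (0ℚ ℚ.<_)
    (trans (solve 3 (λ p q d → (p :+ d) :+ (d :- (p :- q)) := q :+ (d :+ d))
             refl (seq x n) (seq y n) δ)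
           (cong (seq y n ℚ.+_) δ+δ≡ε))
    (0<-+ (h n (ℕ.m⊔n≤o⇒m≤o M N b))
          (p<q⇒0<q-p (ℚ.≤-<-trans (p≤∣p∣ _) (k n (ℕ.m⊔n≤o⇒n≤o M N b)))))
  where open ℚ-Solver

0≤-+ : ∀ x y → 0ℝ ≤ x → 0ℝ ≤ y → 0ℝ ≤ x + y
0≤-+ x y 0≤x 0≤y ε ε>0 =
  let δ , δ>0 , δ+δ≡ε = halve ε ε>0
      M , h = 0≤x δ δ>0
      N , k = 0≤y δ δ>0
  in M ℕ.⊔ N , λ n b → subst (0ℚ ℚ.<_)
    (trans (solve 3 (λ p q d → (p :+ d) :+ (q :+ d) := (p :+ q) :+ (d :+ d))
             refl (seq x n) (seq y n) δ)
           (cong (seq x n ℚ.+ seq y n ℚ.+_) δ+δ≡ε))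
    (0<-+ (h n (ℕ.m⊔n≤o⇒m≤o M N b)) (k n (ℕ.m⊔n≤o⇒n≤o M N b)))
  where open ℚ-Solver

eventually-bounded : ∀ x → ∃[ K ] ∃[ N ] (∀ n → N ℕ.≤ n → seq x n ℚ.< ι (+ suc K))
eventually-bounded x =
  let N , h = cauchy x 1ℚ (ℚ.positive⁻¹ 1ℚ)
      K , b = archimedean (seq x N ℚ.+ 1ℚ)
  in K , N , λ n N≤n → ℚ.<-trans
    (subst (ℚ._< seq x N ℚ.+ 1ℚ)
      (solve 2 (λ p q → q :+ (p :- q) := p) refl (seq x n) (seq x N))
      (ℚ.+-monoʳ-< (seq x N) (ℚ.≤-<-trans (p≤∣p∣ _) (h n N N≤n ℕ.≤-refl))))
    b
  where open ℚ-Solver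

-- From `(x + ζ)(y + δ) > 0` follows `xy > - δx - ζ(y + δ)`. Eventual upper bounds on `x` and
-- `y + δ` keep each error term within ε/2; the second bound can be chosen only after `δ`.
0≤-* : ∀ x y → 0ℝ ≤ x → 0ℝ ≤ y → 0ℝ ≤ x * y
0≤-* x y 0≤x 0≤y ε ε>0 =
  let η , η>0 , η+η≡ε = halve ε ε>0
      A , M₁ , x<A = eventually-bounded x
      δ , δ>0 , Aδ≡η = divide η η>0 A
      M₂ , y>-δ = 0≤y δ δ>0
      B , M₃ , y+δ<B = eventually-bounded (y + fromℚ δ)
      ζ , ζ>0 , Bζ≡η = divide η η>0 B
      M₄ , x>-ζ = 0≤x ζ ζ>0
  in (M₁ ℕ.⊔ M₂) ℕ.⊔ (M₃ ℕ.⊔ M₄) , λ n b →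
  let b₁₂ = ℕ.m⊔n≤o⇒m≤o (M₁ ℕ.⊔ M₂) _ b
      b₃₄ = ℕ.m⊔n≤o⇒n≤o (M₁ ℕ.⊔ M₂) _ b
  in subst (0ℚ ℚ.<_)
    (trans (identity (seq x n) (seq y n) ζ δ (ι (+ suc A)) (ι (+ suc B)))
           (cong (seq x n ℚ.* seq y n ℚ.+_) (trans (cong₂ ℚ._+_ Aδ≡η Bζ≡η) η+η≡ε)))
    (0<-+ (0<-+
      (0<-* (x>-ζ n (ℕ.m⊔n≤o⇒n≤o M₃ M₄ b₃₄)) (y>-δ n (ℕ.m⊔n≤o⇒n≤o M₁ M₂ b₁₂)))
      (0<-* δ>0 (p<q⇒0<q-p (x<A n (ℕ.m⊔n≤o⇒m≤o M₁ M₂ b₁₂)))))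
      (0<-* ζ>0 (p<q⇒0<q-p (y+δ<B n (ℕ.m⊔n≤o⇒m≤o M₃ M₄ b₃₄)))))
  where
  open ℚ-Solver
  identity : ∀ p q ζ δ a b → (p ℚ.+ ζ) ℚ.* (q ℚ.+ δ) ℚ.+ δ ℚ.* (a ℚ.- p)
             ℚ.+ ζ ℚ.* (b ℚ.- (q ℚ.+ δ)) ≡ p ℚ.* q ℚ.+ (a ℚ.* δ ℚ.+ b ℚ.* ζ)
  identity = solve 6 (λ p q ζ δ a b →
    (p :+ ζ) :* (q :+ δ) :+ δ :* (a :- p) :+ ζ :* (b :- (q :+ δ))
      := p :* q :+ (a :* δ :+ b :* ζ)) refl

0≤-fromℚ : ∀ q → 0ℚ ℚ.≤ q → 0ℝ ≤ fromℚ q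
0≤-fromℚ q 0≤q ε ε>0 = 0 , λ _ _ → ℚ.+-mono-≤-< 0≤q ε>0

0≤-ι : ∀ n → 0ℝ ≤ fromℚ (ι (+ n))
0≤-ι n = 0≤-fromℚ (ι (+ n)) (ι-mono-≤ (ℤ.+≤+ ℕ.z≤n))

0≤-fromℚ⁻¹ : ∀ q → 0ℝ ≤ fromℚ q → 0ℚ ℚ.≤ q
0≤-fromℚ⁻¹ q 0≤q = ℚ.≮⇒≥ λ q<0 →
  let N , h = 0≤q (ℚ.- q) (ℚ.neg-antimono-< q<0)
  in ℚ.<-irrefl (sym (ℚ.+-inverseʳ q)) (h N ℕ.≤-refl)

0<q-p⇒p<q : ∀ p q → 0ℚ ℚ.< q ℚ.- p → p ℚ.< q
0<q-p⇒p<q p q h = subst₂ ℚ._<_ (ℚ.+-identityʳ p)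
  (solve 2 (λ p q → p :+ (q :- p) := q) refl p q) (ℚ.+-monoʳ-< p h)
  where open ℚ-Solver

-ε<p<ε⇒∣p∣<ε : ∀ p ε → 0ℚ ℚ.< p ℚ.+ ε → 0ℚ ℚ.< ε ℚ.- p → ∣ p ∣ ℚ.< ε
-ε<p<ε⇒∣p∣<ε p ε l r with ℚ.≤-total 0ℚ p
... | inj₁ 0≤p = subst (ℚ._< ε) (sym (ℚ.0≤p⇒∣p∣≡p 0≤p)) (0<q-p⇒p<q p ε r)
... | inj₂ p≤0 = subst (ℚ._< ε)
  (trans (sym (ℚ.0≤p⇒∣p∣≡p (ℚ.neg-antimono-≤ p≤0))) (ℚ.∣-p∣≡∣p∣ p))
  (0<q-p⇒p<q (ℚ.- p) ε (subst (0ℚ ℚ.<_)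
    (solve 2 (λ p e → p :+ e := e :- (:- p)) refl p ε) l))
  where open ℚ-Solver

0≤-antisym : ∀ x y → 0ℝ ≤ x - y → 0ℝ ≤ y - x → x ≈ y
0≤-antisym x y y≤x x≤y ε ε>0 =
  let M , h = y≤x ε ε>0
      N , k = x≤y ε ε>0
  in M ℕ.⊔ N , λ n b → -ε<p<ε⇒∣p∣<ε (seq x n ℚ.- seq y n) ε
    (h n (ℕ.m⊔n≤o⇒m≤o M N b))
    (subst (0ℚ ℚ.<_)
      (solve 3 (λ p q e → (q :- p) :+ e := e :- (p :- q)) refl (seq x n) (seq y n) ε)
      (k n (ℕ.m⊔n≤o⇒n≤o M N b)))
  where open ℚ-Solver

0≤-≈ : ∀ x y → x ≈ y → 0ℝ ≤ x - y
0≤-≈ x y x≈y ε ε>0 =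
  let N , h = x≈y ε ε>0
  in N , λ n b → subst (0ℚ ℚ.<_)
    (solve 3 (λ p q e → e :- (q :- p) := (p :- q) :+ e) refl (seq x n) (seq y n) ε)
    (p<q⇒0<q-p (ℚ.≤-<-trans (p≤∣p∣ _) (subst (ℚ._< ε) (swap (seq x n) (seq y n)) (h n b))))
  where
  open ℚ-Solver
  swap : ∀ p q → ∣ p ℚ.- q ∣ ≡ ∣ q ℚ.- p ∣
  swap p q = trans (sym (ℚ.∣-p∣≡∣p∣ (p ℚ.- q)))
    (cong ∣_∣ (solve 2 (λ p q → :- (p :- q) := q :- p) refl p q))

-- A number that is not at most -1/(d+1) for any d is nonnegative; no case
-- distinction on reals is needed since one late term of the sequence decides.
0≤-stable : ∀ x → (∀ d → ¬ 0ℝ ≤ - (fromℚ (ι (+ suc d)) * x) - 1ℝ) → 0ℝ ≤ x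
0≤-stable x ¬x<0 ε ε>0 =
  let δ , δ>0 , 3δ≡ε = divide ε ε>0 2
      N , h = cauchy x δ δ>0
      below = λ n b → ℚ.≤-<-trans (p≤∣p∣ _) (h n N b ℕ.≤-refl)
      above = λ n b → ℚ.≤-<-trans (p≤∣p∣ _) (h N n ℕ.≤-refl b)
  in N , decide δ δ>0 3δ≡ε N
       (λ n b → p<q⇒0<q-p (below n b)) (λ n b → p<q⇒0<q-p (above n b))
  where
  open ℚ-Solver
  decide : ∀ δ → 0ℚ ℚ.< δ → ι (+ 3) ℚ.* δ ≡ ε → ∀ N →
    (∀ n → N ℕ.≤ n → 0ℚ ℚ.< δ ℚ.- (seq x n ℚ.- seq x N)) →
    (∀ n → N ℕ.≤ n → 0ℚ ℚ.< δ ℚ.- (seq x N ℚ.- seq x n)) →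
    ∀ n → N ℕ.≤ n → 0ℚ ℚ.< seq x n ℚ.+ ε
  -- The single term `x_N` is compared with `-2δ`. If it is larger, all later terms exceed
  -- `-3δ = -ε`; otherwise they stay below `-δ`, and any `d` with `(d + 1)δ > 1` contradicts the
  -- hypothesis.
  decide δ δ>0 3δ≡ε N below above with 0ℚ ℚ.<? seq x N ℚ.+ (δ ℚ.+ δ)
  ... | yes p = λ n b → subst (0ℚ ℚ.<_)
    (trans (solve 3 (λ a c d → (c :+ (d :+ d)) :+ (d :- (c :- a)) := a :+ con (ι (+ 3)) :* d)
             refl (seq x n) (seq x N) δ)
           (cong (seq x n ℚ.+_) 3δ≡ε))
    (0<-+ p (above n b))
  ... | no ¬p = contradiction negative (¬x<0 d)
    where
    1/δ = ℚ.1/_ δ {{ℚ.pos⇒nonZero δ {{ℚ.positive δ>0}}}}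
    d = proj₁ (archimedean 1/δ)
    1≤[1+d]δ : 0ℚ ℚ.< ι (+ suc d) ℚ.* δ ℚ.- 1ℚ
    1≤[1+d]δ = p<q⇒0<q-p (subst (ℚ._< ι (+ suc d) ℚ.* δ)
      (ℚ.*-inverseˡ δ {{ℚ.pos⇒nonZero δ {{ℚ.positive δ>0}}}})
      (ℚ.*-monoˡ-<-pos δ {{ℚ.positive δ>0}} (proj₂ (archimedean 1/δ))))
    xN≤-2δ : 0ℚ ℚ.≤ ℚ.- (seq x N ℚ.+ (δ ℚ.+ δ))
    xN≤-2δ = ℚ.neg-antimono-≤ (ℚ.≮⇒≥ ¬p)
    negative : 0ℝ ≤ - (fromℚ (ι (+ suc d)) * x) - 1ℝ
    negative ε′ ε′>0 = N , λ n b → subst (0ℚ ℚ.<_)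
      (solve 5 (λ a c δ k e → k :* ((:- (c :+ (δ :+ δ))) :+ (δ :- (a :- c))) :+ (k :* δ :- con 1ℚ) :+ e
          := ((:- (k :* a)) :- con 1ℚ) :+ e)
        refl (seq x n) (seq x N) δ (ι (+ suc d)) ε′)
      (0<-+ (0<-+ (0<-* (0<ι[1+n] d) (ℚ.+-mono-≤-< xN≤-2δ (below n b))) 1≤[1+d]δ) ε′>0)

-- Half-planes with integer coefficients

affine : ℤ → ℤ → ℤ → ℝ² → ℝ
affine a b c (x , y) = fromℚ (ι a) * x + fromℚ (ι b) * y + fromℚ (ι c)

-- All incidences are expressed by such inequalities with integer coefficients. Adding nonnegative
-- multiples until `x` and `y` cancel leaves an inequality between integers, which is decidable
-- although the order of the reals is not.
record HalfPlane (a b c : ℤ) (z : ℝ²) : Set where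
  constructor halfPlane
  field
    nonNeg : 0ℝ ≤ affine a b c z

open HalfPlane

private variable
  a b c a′ b′ c′ s s′ : ℤ
  z w p q : ℝ²

halfPlane-cong : a ≡ a′ → b ≡ b′ → c ≡ c′ → HalfPlane a b c z → HalfPlane a′ b′ c′ z
halfPlane-cong refl refl refl h = h

halfPlane-+ : HalfPlane a b c z → HalfPlane a′ b′ c′ z →
              HalfPlane (a ℤ.+ a′) (b ℤ.+ b′) (c ℤ.+ c′) z
halfPlane-+ {a} {b} {c} {z@(x , y)} {a′} {b′} {c′} (halfPlane h) (halfPlane k) = halfPlane
  (0≤-≗ (affine a b c z + affine a′ b′ c′ z) (affine (a ℤ.+ a′) (b ℤ.+ b′) (c ℤ.+ c′) z) (λ n → sym (trans
    (cong₂ ℚ._+_ (cong₂ ℚ._+_ (cong (ℚ._* seq x n) (ι-+ a a′)) (cong (ℚ._* seq y n) (ι-+ b b′))) (ι-+ c c′))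
    (identity (ι a) (ι b) (ι c) (ι a′) (ι b′) (ι c′) (seq x n) (seq y n))))
    (0≤-+ (affine a b c z) (affine a′ b′ c′ z) h k))
  where
  open ℚ-Solver
  identity : ∀ a b c a′ b′ c′ x y →
    (a ℚ.+ a′) ℚ.* x ℚ.+ (b ℚ.+ b′) ℚ.* y ℚ.+ (c ℚ.+ c′)
      ≡ (a ℚ.* x ℚ.+ b ℚ.* y ℚ.+ c) ℚ.+ (a′ ℚ.* x ℚ.+ b′ ℚ.* y ℚ.+ c′)
  identity = solve 8 (λ a b c a′ b′ c′ x y →
    (a :+ a′) :* x :+ (b :+ b′) :* y :+ (c :+ c′)
      := (a :* x :+ b :* y :+ c) :+ (a′ :* x :+ b′ :* y :+ c′)) refl

halfPlane-* : ∀ n → HalfPlane a b c z →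
              HalfPlane (+ n ℤ.* a) (+ n ℤ.* b) (+ n ℤ.* c) z
halfPlane-* {a} {b} {c} {z@(x , y)} n (halfPlane h) = halfPlane
  (0≤-≗ (fromℚ (ι (+ n)) * affine a b c z) (affine (+ n ℤ.* a) (+ n ℤ.* b) (+ n ℤ.* c) z) (λ m → sym (trans
    (cong₂ ℚ._+_ (cong₂ ℚ._+_ (cong (ℚ._* seq x m) (ι-* (+ n) a)) (cong (ℚ._* seq y m) (ι-* (+ n) b)))
                 (ι-* (+ n) c))
    (identity (ι a) (ι b) (ι c) (ι (+ n)) (seq x m) (seq y m))))
    (0≤-* (fromℚ (ι (+ n))) (affine a b c z) (0≤-ι n) h))
  where
  open ℚ-Solver
  identity : ∀ a b c n x y → (n ℚ.* a) ℚ.* x ℚ.+ (n ℚ.* b) ℚ.* y ℚ.+ n ℚ.* c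
    ≡ n ℚ.* (a ℚ.* x ℚ.+ b ℚ.* y ℚ.+ c)
  identity = solve 6 (λ a b c n x y →
    (n :* a) :* x :+ (n :* b) :* y :+ n :* c := n :* (a :* x :+ b :* y :+ c)) refl

halfPlane-const⁻¹ : HalfPlane 0ℤ 0ℤ c z → 0ℤ ℤ.≤ c
halfPlane-const⁻¹ {c} {z@(x , y)} (halfPlane h) = ι-cancel-≤ (0≤-fromℚ⁻¹ (ι c)
  (0≤-≗ (affine 0ℤ 0ℤ c z) (fromℚ (ι c))
    (λ n → solve 3 (λ x y c → con 0ℚ :* x :+ con 0ℚ :* y :+ c := c) refl (seq x n) (seq y n) (ι c)) h))
  where open ℚ-Solver

point : ℤ → ℤ → ℝ²
point x y = fromℚ (ι x) , fromℚ (ι y)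

halfPlane-point : ∀ a b c x y → 0ℤ ℤ.≤ a ℤ.* x ℤ.+ b ℤ.* y ℤ.+ c → HalfPlane a b c (point x y)
halfPlane-point a b c x y h = halfPlane
  (0≤-≗ (fromℚ (ι (a ℤ.* x ℤ.+ b ℤ.* y ℤ.+ c))) (affine a b c (point x y)) (λ _ →
    trans (ι-+ (a ℤ.* x ℤ.+ b ℤ.* y) c) (cong (ℚ._+ ι c)
      (trans (ι-+ (a ℤ.* x) (b ℤ.* y)) (cong₂ ℚ._+_ (ι-* a x) (ι-* b y)))))
    (0≤-fromℚ (ι (a ℤ.* x ℤ.+ b ℤ.* y ℤ.+ c)) (ι-mono-≤ h)))

0≤-scaled-difference : ∀ a x y → x ≈ y → 0ℝ ≤ fromℚ (ι a) * (x - y)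
0≤-scaled-difference (+ n) x y x≈y =
  0≤-* (fromℚ (ι (+ n))) (x - y) (0≤-ι n) (0≤-≈ x y x≈y)
0≤-scaled-difference -[1+ n ] x y x≈y =
  0≤-≗ (fromℚ (ι (+ suc n)) * (y - x)) (fromℚ (ι -[1+ n ]) * (x - y)) (λ m → trans
    (solve 3 (λ k x y → k :* (y :- x) := (:- k) :* (x :- y)) refl (ι (+ suc n)) (seq x m) (seq y m))
    (cong (ℚ._* (seq x m ℚ.- seq y m)) (sym (ι-neg (+ suc n)))))
    (0≤-* (fromℚ (ι (+ suc n))) (y - x) (0≤-ι (suc n))
      (0≤-≈ y x (≈-sym {x} {y} x≈y)))
  where open ℚ-Solver

halfPlane-resp : ∀ {a b c} → HalfPlane a b c Respects _≈²_
halfPlane-resp {a} {b} {c} {z@(x , y)} {w@(u , v)} (x≈u , y≈v) (halfPlane h) = halfPlane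
  (0≤-≗ (affine a b c z + fromℚ (ι a) * (u - x) + fromℚ (ι b) * (v - y)) (affine a b c w)
    (λ n → identity (ι a) (ι b) (ι c) (seq x n) (seq y n) (seq u n) (seq v n))
    (0≤-+ (affine a b c z + fromℚ (ι a) * (u - x)) (fromℚ (ι b) * (v - y))
      (0≤-+ (affine a b c z) (fromℚ (ι a) * (u - x)) h
        (0≤-scaled-difference a u x (≈-sym {x} {u} x≈u)))
      (0≤-scaled-difference b v y (≈-sym {y} {v} y≈v))))
  where
  open ℚ-Solver
  identity : ∀ a b c x y u v → (a ℚ.* x ℚ.+ b ℚ.* y ℚ.+ c) ℚ.+ a ℚ.* (u ℚ.- x) ℚ.+ b ℚ.* (v ℚ.- y)
    ≡ a ℚ.* u ℚ.+ b ℚ.* v ℚ.+ c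
  identity = solve 7 (λ a b c x y u v →
    (a :* x :+ b :* y :+ c) :+ a :* (u :- x) :+ b :* (v :- y) := a :* u :+ b :* v :+ c) refl

0≤1-t : ∀ t → t ≤ 1ℝ → 0ℝ ≤ 1ℝ - t
0≤1-t t t≤1 ε ε>0 =
  let N , h = t≤1 ε ε>0
  in N , λ n b → subst (0ℚ ℚ.<_)
    (solve 2 (λ t e → (con 1ℚ :+ e) :- t := (con 1ℚ :- t) :+ e) refl (seq t n) ε)
    (p<q⇒0<q-p (h n b))
  where open ℚ-Solver

between : ℝ² → ℝ² → ℝ → ℝ²
between (x , y) (u , v) t = (1ℝ - t) * x + t * u , (1ℝ - t) * y + t * v

affine-between : ∀ a b c p q t n → seq (affine a b c (between p q t)) n
  ≡ (1ℚ ℚ.- seq t n) ℚ.* seq (affine a b c p) n ℚ.+ seq t n ℚ.* seq (affine a b c q) n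
affine-between a b c (x , y) (u , v) t n =
  identity (ι a) (ι b) (ι c) (seq x n) (seq y n) (seq u n) (seq v n) (seq t n)
  where
  open ℚ-Solver
  identity : ∀ a b c x y u v t →
    a ℚ.* ((1ℚ ℚ.- t) ℚ.* x ℚ.+ t ℚ.* u) ℚ.+ b ℚ.* ((1ℚ ℚ.- t) ℚ.* y ℚ.+ t ℚ.* v) ℚ.+ c
      ≡ (1ℚ ℚ.- t) ℚ.* (a ℚ.* x ℚ.+ b ℚ.* y ℚ.+ c) ℚ.+ t ℚ.* (a ℚ.* u ℚ.+ b ℚ.* v ℚ.+ c)
  identity = solve 8 (λ a b c x y u v t →
    a :* ((con 1ℚ :- t) :* x :+ t :* u) :+ b :* ((con 1ℚ :- t) :* y :+ t :* v) :+ c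
      := (con 1ℚ :- t) :* (a :* x :+ b :* y :+ c) :+ t :* (a :* u :+ b :* v :+ c)) refl

halfPlane-convex : HalfPlane a b c p → HalfPlane a b c q → [ p ⟷ q ] ⊆ HalfPlane a b c
halfPlane-convex {a} {b} {c} {p} {q} (halfPlane h) (halfPlane k) {z} (t , 0≤t , t≤1 , (e , f)) =
  halfPlane-resp {x = between p q t} {z}
    (≈-sym {proj₁ z} {proj₁ (between p q t)} e , ≈-sym {proj₂ z} {proj₂ (between p q t)} f)
    (halfPlane (0≤-≗ ((1ℝ - t) * affine a b c p + t * affine a b c q) (affine a b c (between p q t))
      (λ n → sym (affine-between a b c p q t n))
      (0≤-+ ((1ℝ - t) * affine a b c p) (t * affine a b c q)
        (0≤-* (1ℝ - t) (affine a b c p) (0≤1-t t t≤1) h)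
        (0≤-* t (affine a b c q) 0≤t k))))

halfPlane-stable : ¬ ¬ HalfPlane a b c z → HalfPlane a b c z
halfPlane-stable {a} {b} {c} {z} ¬¬h = halfPlane (0≤-stable u λ d u<0 → ¬¬h λ (halfPlane 0≤u) →
  let open ℚ-Solver
      s = fromℚ (ι (+ suc d))
      -1≥0 = 0≤-≗ (s * u + (- (s * u) - 1ℝ)) (fromℚ (ι -1ℤ))
        (λ n → solve 2 (λ s u → s :* u :+ ((:- (s :* u)) :- con 1ℚ) := con (ι -1ℤ)) refl (ι (+ suc d)) (seq u n))
        (0≤-+ (s * u) (- (s * u) - 1ℝ)
          (0≤-* s u (0≤-ι (suc d)) 0≤u) u<0)
  in 0≰-1 (ι-cancel-≤ {0ℤ} {b = -1ℤ} (0≤-fromℚ⁻¹ (ι -1ℤ) -1≥0)))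
  where
  u = affine a b c z
  0≰-1 : ¬ (0ℤ ℤ.≤ -1ℤ)
  0≰-1 ()

-- Behaviour of half-planes near the end of a segment

-- The points of [p ⟷ q] used to look at a segment near its end point p.
sample : ℝ² → ℝ² → ℕ → ℝ²
sample p q N = between p q (fromℚ (ℚ.1/ ι (+ suc N)))

sample∈segment : ∀ p q N → sample p q N ∈ [ p ⟷ q ]
sample∈segment p q N = t , 0≤t , t≤1 ,
  ≈-refl {proj₁ (sample p q N)} , ≈-refl {proj₂ (sample p q N)}
  where
  open ℚ.≤-Reasoning
  k r : ℚ
  k = ι (+ suc N)
  r = ℚ.1/ k
  t = fromℚ r
  instance _ = ℚ.1/pos⇒pos k
  0≤t : 0ℝ ≤ t
  0≤t = 0≤-fromℚ r (ℚ.<⇒≤ (ℚ.positive⁻¹ r))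
  r≤1 : r ℚ.≤ 1ℚ
  r≤1 = begin
    r           ≡⟨ ℚ.*-identityˡ r ⟨
    1ℚ ℚ.* r    ≤⟨ ℚ.*-monoʳ-≤-nonNeg r {{ℚ.pos⇒nonNeg r}} (ι-mono-≤ {1ℤ} {+ suc N} (ℤ.+≤+ (ℕ.s≤s ℕ.z≤n))) ⟩
    k ℚ.* r     ≡⟨ ℚ.*-inverseʳ k ⟩
    1ℚ          ∎
  t≤1 : t ≤ 1ℝ
  t≤1 ε ε>0 = 0 , λ _ _ → ℚ.≤-<-trans r≤1
    (subst (ℚ._< 1ℚ ℚ.+ ε) (ℚ.+-identityʳ 1ℚ) (ℚ.+-monoʳ-< 1ℚ ε>0))

-- At parameter `1 / (N + 1)` the affine function has the value `(N P + Q) / (N + 1)`, where `P` and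
-- `Q` are its values at `p` and `q`. The pair `(P , Q)` is itself treated as a point of the plane,
-- so half-plane arithmetic applies to it.
halfPlane-sample : ∀ {N} → HalfPlane a b c (sample p q N) →
                   HalfPlane (+ N) 1ℤ 0ℤ (affine a b c p , affine a b c q)
halfPlane-sample {a} {b} {c} {p} {q} {N} (halfPlane h) = halfPlane
  (0≤-≗ (fromℚ k * affine a b c (sample p q N)) (affine (+ N) 1ℤ 0ℤ (P , Q)) (λ n → begin
    k ℚ.* seq (affine a b c (sample p q N)) n
      ≡⟨ cong (k ℚ.*_) (affine-between a b c p q (fromℚ r) n) ⟩
    k ℚ.* ((1ℚ ℚ.- r) ℚ.* seq P n ℚ.+ r ℚ.* seq Q n)
      ≡⟨ solve 4 (λ k r P Q → k :* ((con 1ℚ :- r) :* P :+ r :* Q)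
           := (k :- k :* r) :* P :+ (k :* r) :* Q :+ con 0ℚ) refl k r (seq P n) (seq Q n) ⟩
    (k ℚ.- k ℚ.* r) ℚ.* seq P n ℚ.+ (k ℚ.* r) ℚ.* seq Q n ℚ.+ 0ℚ
      ≡⟨ cong₂ (λ u v → u ℚ.* seq P n ℚ.+ v ℚ.* seq Q n ℚ.+ 0ℚ) k-kr≡N kr≡1 ⟩
    ι (+ N) ℚ.* seq P n ℚ.+ 1ℚ ℚ.* seq Q n ℚ.+ 0ℚ ∎)
    (0≤-* (fromℚ k) (affine a b c (sample p q N)) (0≤-ι (suc N)) h))
  where
  open ≡-Reasoning
  open ℚ-Solver
  k r : ℚ
  k = ι (+ suc N)
  r = ℚ.1/ k
  P Q : ℝ
  P = affine a b c p
  Q = affine a b c q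
  kr≡1 : k ℚ.* r ≡ 1ℚ
  kr≡1 = ℚ.*-inverseʳ k
  k-kr≡N : k ℚ.- k ℚ.* r ≡ ι (+ N)
  k-kr≡N = begin
    k ℚ.- k ℚ.* r             ≡⟨ cong (λ u → k ℚ.- u) kr≡1 ⟩
    k ℚ.- 1ℚ                  ≡⟨ cong (ℚ._- 1ℚ) (ι-+ 1ℤ (+ N)) ⟩
    1ℚ ℚ.+ ι (+ N) ℚ.- 1ℚ     ≡⟨ solve 1 (λ m → con 1ℚ :+ m :- con 1ℚ := m) refl (ι (+ N)) ⟩
    ι (+ N)                   ∎

-- A classical rendering of "infinitely often": it yields witnesses only under a double negation,
-- and it is what a refutation of eventual failure provides.
Frequently : Pred ℕ 0ℓ → Set
Frequently P = ∀ M → ¬ ∀ N → M ≤ℕ N → ¬ P N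

frequently-map : ∀ {P Q : Pred ℕ 0ℓ} → P ⊆ Q → Frequently P → Frequently Q
frequently-map P⊆Q freq M never = freq M λ N M≤N p → never N M≤N (P⊆Q p)

halfPlane-bound : ∀ x y → ∃[ K ] HalfPlane 0ℤ -1ℤ (+ K) (x , y)
halfPlane-bound x y =
  let K , N , h = eventually-bounded y
  in suc K , halfPlane λ ε ε>0 → N , λ n b → subst (0ℚ ℚ.<_)
    (solve 4 (λ x y k e → k :- y :+ e := con 0ℚ :* x :+ con (ι -1ℤ) :* y :+ k :+ e)
      refl (seq x n) (seq y n) (ι (+ suc K)) ε)
    (0<-+ (p<q⇒0<q-p (h n b)) ε>0)
  where open ℚ-Solver

-- If `x ≤ -1 / (d + 1)` and `y ≤ K`, then `N x + y ≥ 0` forces `N ≤ (d + 1) K`, which cannot hold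
-- for arbitrarily large `N`.
0≤-limit : ∀ x y → Frequently (λ N → HalfPlane (+ N) 1ℤ 0ℤ (x , y)) → 0ℝ ≤ x
0≤-limit x y freq = 0≤-stable x λ d x<0 →
  let K , y≤K = halfPlane-bound x y
  in freq (suc (suc d ℕ.* K)) λ N N> h → ℕ.<⇒≱ N> (bound d N K (negative d x<0) h y≤K)
  where
  negative : ∀ d → 0ℝ ≤ - (fromℚ (ι (+ suc d)) * x) - 1ℝ → HalfPlane (ℤ.- (+ suc d)) 0ℤ -1ℤ (x , y)
  negative d x<0 = halfPlane (0≤-≗ (- (fromℚ (ι (+ suc d)) * x) - 1ℝ) (affine (ℤ.- (+ suc d)) 0ℤ -1ℤ (x , y))
    (λ n → trans
      (solve 3 (λ s x y → (:- (s :* x)) :- con 1ℚ := (:- s) :* x :+ con 0ℚ :* y :+ con (ι -1ℤ))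
        refl (ι (+ suc d)) (seq x n) (seq y n))
      (cong (λ s → s ℚ.* seq x n ℚ.+ 0ℚ ℚ.* seq y n ℚ.+ ι -1ℤ) (sym (ι-neg (+ suc d)))))
    x<0)
    where open ℚ-Solver
  bound : ∀ d N K → HalfPlane (ℤ.- (+ suc d)) 0ℤ -1ℤ (x , y) → HalfPlane (+ N) 1ℤ 0ℤ (x , y) →
          HalfPlane 0ℤ -1ℤ (+ K) (x , y) → N ≤ℕ suc d ℕ.* K
  bound d N K h₁ h₂ h₃ = ℤ.drop‿+≤+ (subst (+ N ℤ.≤_) (sym (ℤ.pos-* (suc d) K))
    (ℤ.0≤i-j⇒j≤i (halfPlane-const⁻¹ {z = x , y} (halfPlane-cong
      (solve 2 (λ N D → N :* (:- D) :+ D :* N :+ D :* con 0ℤ := con 0ℤ) refl (+ N) (+ suc d))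
      (solve 2 (λ N D → N :* con 0ℤ :+ D :* con 1ℤ :+ D :* con -1ℤ := con 0ℤ) refl (+ N) (+ suc d))
      (solve 3 (λ N D K → N :* con -1ℤ :+ D :* con 0ℤ :+ D :* K := D :* K :- N) refl (+ N) (+ suc d) (+ K))
      (halfPlane-+ (halfPlane-+ (halfPlane-* N h₁) (halfPlane-* (suc d) h₂)) (halfPlane-* (suc d) h₃))))))
    where open ℤ-Solver

halfPlane-closed : Frequently (λ N → HalfPlane a b c (sample p q N)) → HalfPlane a b c p
halfPlane-closed {a} {b} {c} {p} {q} freq = halfPlane
  (0≤-limit (affine a b c p) (affine a b c q)
    (frequently-map (λ {N} → halfPlane-sample {p = p} {q} {N}) freq))

-- An affine function that is nonpositive at p and nonnegative at some other
-- point of [p ⟷ q] is nonnegative at q.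
halfPlane-far : HalfPlane (ℤ.- a) (ℤ.- b) (ℤ.- c) p →
                Frequently (λ N → HalfPlane a b c (sample p q N)) → HalfPlane a b c q
halfPlane-far {a} {b} {c} {p@(x , y)} {q} (halfPlane -p≥0) freq = halfPlane-stable
  λ ¬h → freq 0 λ N _ h → ¬h (halfPlane (extrapolate N (affine a b c p) (affine a b c q)
    (0≤-≗ (affine (ℤ.- a) (ℤ.- b) (ℤ.- c) p) (- affine a b c p) (λ n → trans
      (cong₂ ℚ._+_ (cong₂ ℚ._+_ (cong (ℚ._* seq x n) (ι-neg a)) (cong (ℚ._* seq y n) (ι-neg b))) (ι-neg c))
      (identity (ι a) (ι b) (ι c) (seq x n) (seq y n))) -p≥0)
    (nonNeg (halfPlane-sample {p = p} {q} {N} h))))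
  where
  open ℚ-Solver
  identity : ∀ a b c x y → (ℚ.- a) ℚ.* x ℚ.+ (ℚ.- b) ℚ.* y ℚ.+ (ℚ.- c) ≡ ℚ.- (a ℚ.* x ℚ.+ b ℚ.* y ℚ.+ c)
  identity = solve 5 (λ a b c x y →
    (:- a) :* x :+ (:- b) :* y :+ (:- c) := :- (a :* x :+ b :* y :+ c)) refl
  extrapolate : ∀ N u v → 0ℝ ≤ - u → 0ℝ ≤ affine (+ N) 1ℤ 0ℤ (u , v) → 0ℝ ≤ v
  extrapolate N u v -u≥0 h = 0≤-≗ (affine (+ N) 1ℤ 0ℤ (u , v) + fromℚ (ι (+ N)) * - u) v
    (λ n → solve 3 (λ N u v → (N :* u :+ con 1ℚ :* v :+ con 0ℚ) :+ N :* (:- u) := v)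
      refl (ι (+ N)) (seq u n) (seq v n))
    (0≤-+ (affine (+ N) 1ℤ 0ℤ (u , v)) (fromℚ (ι (+ N)) * - u) h
      (0≤-* (fromℚ (ι (+ N))) (- u) (0≤-ι N) -u≥0))

0≤-cancel-* : ∀ n x → 0ℝ ≤ fromℚ (ι (+ suc n)) * x → 0ℝ ≤ x
0≤-cancel-* n x h = 0≤-≗ (fromℚ r * (fromℚ k * x)) x
  (λ m → begin
    r ℚ.* (k ℚ.* seq x m)    ≡⟨ ℚ.*-assoc r k (seq x m) ⟨
    r ℚ.* k ℚ.* seq x m      ≡⟨ cong (ℚ._* seq x m) (ℚ.*-inverseˡ k) ⟩
    1ℚ ℚ.* seq x m           ≡⟨ ℚ.*-identityˡ (seq x m) ⟩
    seq x m                  ∎)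
  (0≤-* (fromℚ r) (fromℚ k * x)
    (0≤-fromℚ r (ℚ.<⇒≤ (ℚ.positive⁻¹ r {{ℚ.1/pos⇒pos k}}))) h)
  where
  open ≡-Reasoning
  k r : ℚ
  k = ι (+ suc n)
  r = ℚ.1/ k

segment-sym : ∀ p q → [ q ⟷ p ] ⊆ [ p ⟷ q ]
segment-sym (x , y) (u , v) {z} (t , 0≤t , t≤1 , e , f) =
  1ℝ - t , 0≤1-t t t≤1 , 1-t≤1 , flip x u (proj₁ z) e , flip y v (proj₂ z) f
  where
  open ℚ-Solver
  1-t≤1 : 1ℝ - t ≤ 1ℝ
  1-t≤1 ε ε>0 =
    let N , h = 0≤t ε ε>0
    in N , λ n b → 0<q-p⇒p<q (1ℚ ℚ.- seq t n) (1ℚ ℚ.+ ε) (subst (0ℚ ℚ.<_)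
      (solve 2 (λ t e → t :+ e := (con 1ℚ :+ e) :- (con 1ℚ :- t)) refl (seq t n) ε) (h n b))
  flip : ∀ x u w → w ≈ (1ℝ - t) * u + t * x → w ≈ (1ℝ - (1ℝ - t)) * x + (1ℝ - t) * u
  flip x u w e = ≈-trans {w} {(1ℝ - t) * u + t * x} {(1ℝ - (1ℝ - t)) * x + (1ℝ - t) * u} e
    (≗⇒≈ ((1ℝ - t) * u + t * x) ((1ℝ - (1ℝ - t)) * x + (1ℝ - t) * u)
      (λ n → solve 3 (λ t x u → (con 1ℚ :- t) :* u :+ t :* x
          := (con 1ℚ :- (con 1ℚ :- t)) :* x :+ (con 1ℚ :- t) :* u)
        refl (seq t n) (seq x n) (seq u n)))

-- Lines given by slope and intercept

i-j≡-[j-i] : ∀ i j → i ℤ.- j ≡ ℤ.- (j ℤ.- i)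
i-j≡-[j-i] = solve 2 (λ i j → i :- j := :- (j :- i)) refl
  where open ℤ-Solver

record OnLine (s c : ℤ) (z : ℝ²) : Set where
  constructor onLine
  field
    below : HalfPlane s -1ℤ c z
    above : HalfPlane (ℤ.- s) 1ℤ (ℤ.- c) z

open OnLine

-- Subtracting the two equations eliminates `y` and leaves a condition on the abscissa alone.
-- Exchanging the arguments gives the opposite inequality.
crossing : OnLine s c z → OnLine s′ c′ z → HalfPlane (s ℤ.- s′) 0ℤ (c ℤ.- c′) z
crossing l m = halfPlane-+ (below l) (above m)

parallel : OnLine s c z → OnLine s c′ z → c ≡ c′
parallel {s} {c} {z} {c′} l m = ℤ.≤-antisym (bound m l) (bound l m)
  where
  bound : ∀ {c c′} → OnLine s c z → OnLine s c′ z → c′ ℤ.≤ c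
  bound l m = ℤ.0≤i-j⇒j≤i (halfPlane-const⁻¹ {z = z}
    (halfPlane-cong (ℤ.+-inverseʳ s) refl refl (crossing l m)))

-- The slope difference times `x - u` vanishes, so the abscissae agree; then the ordinates do, both
-- being given by the first line.
lines-meet-once : s ≢ s′ → OnLine s c p → OnLine s′ c′ p → OnLine s c q → OnLine s′ c′ q → p ≈² q
lines-meet-once {s} {s′} {c} {p@(x , y)} {c′} {q@(u , v)} s≢s′ lp mp lq mq =
  x≈u , 0≤-antisym y v
    (difference x y u v x≈u (above lp) (below lq))
    (difference u v x y (≈-sym {x} {u} x≈u) (above lq) (below lp))
  where
  shift : ∀ {d e} x y u v → HalfPlane d 0ℤ e (x , y) → HalfPlane (ℤ.- d) 0ℤ (ℤ.- e) (u , v) →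
          0ℝ ≤ fromℚ (ι d) * (x - u)
  shift {d} {e} x y u v (halfPlane h) (halfPlane k) =
    0≤-≗ (affine d 0ℤ e (x , y) + affine (ℤ.- d) 0ℤ (ℤ.- e) (u , v)) (fromℚ (ι d) * (x - u))
      (λ n → trans
        (cong (seq (affine d 0ℤ e (x , y)) n ℚ.+_)
          (cong₂ (λ α β → α ℚ.* seq u n ℚ.+ 0ℚ ℚ.* seq v n ℚ.+ β) (ι-neg d) (ι-neg e)))
        (identity (ι d) (ι e) (seq x n) (seq y n) (seq u n) (seq v n)))
      (0≤-+ (affine d 0ℤ e (x , y)) (affine (ℤ.- d) 0ℤ (ℤ.- e) (u , v)) h k)
    where
    open ℚ-Solver
    identity : ∀ d e x y u v → (d ℚ.* x ℚ.+ 0ℚ ℚ.* y ℚ.+ e) ℚ.+ ((ℚ.- d) ℚ.* u ℚ.+ 0ℚ ℚ.* v ℚ.+ (ℚ.- e))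
                               ≡ d ℚ.* (x ℚ.- u)
    identity = solve 6 (λ d e x y u v →
      (d :* x :+ con 0ℚ :* y :+ e) :+ ((:- d) :* u :+ con 0ℚ :* v :+ (:- e)) := d :* (x :- u)) refl
  abscissa : ∀ {s s′ c c′ n} → s ℤ.- s′ ≡ + suc n → ∀ x y u v →
             OnLine s c (x , y) → OnLine s′ c′ (x , y) →
             OnLine s c (u , v) → OnLine s′ c′ (u , v) → 0ℝ ≤ x - u
  abscissa {s} {s′} {c} {c′} {n} eq x y u v lp mp lq mq =
    0≤-cancel-* n (x - u) (subst (λ d → 0ℝ ≤ fromℚ (ι d) * (x - u)) eq
      (shift x y u v (crossing lp mp)
        (halfPlane-cong (i-j≡-[j-i] s′ s) refl (i-j≡-[j-i] c′ c) (crossing mq lq))))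
  x≈u : x ≈ u
  -- Cancelling the slope difference requires a positive factor; if it is negative, the two lines
  -- exchange roles.
  x≈u with s ℤ.- s′ in eq
  ... | + zero   = contradiction (ℤ.i-j≡0⇒i≡j s s′ eq) s≢s′
  ... | + suc _  = 0≤-antisym x u (abscissa eq x y u v lp mp lq mq) (abscissa eq u v x y lq mq lp mp)
  ... | -[1+ _ ] = 0≤-antisym x u (abscissa eq′ x y u v mp lp mq lq) (abscissa eq′ u v x y mq lq mp lp)
    where eq′ = trans (i-j≡-[j-i] s′ s) (cong ℤ.-_ eq)
  difference : ∀ x y u v → x ≈ u → HalfPlane (ℤ.- s) 1ℤ (ℤ.- c) (x , y) → HalfPlane s -1ℤ c (u , v) →
               0ℝ ≤ y - v
  difference x y u v x≈u (halfPlane h) (halfPlane k) =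
    0≤-≗ (affine (ℤ.- s) 1ℤ (ℤ.- c) (x , y) + affine s -1ℤ c (u , v) + fromℚ (ι s) * (x - u)) (y - v)
      (λ n → trans
        (cong (λ r → r ℚ.+ seq (affine s -1ℤ c (u , v)) n ℚ.+ ι s ℚ.* (seq x n ℚ.- seq u n))
          (cong₂ (λ α β → α ℚ.* seq x n ℚ.+ 1ℚ ℚ.* seq y n ℚ.+ β) (ι-neg s) (ι-neg c)))
        (identity (ι s) (ι c) (seq x n) (seq y n) (seq u n) (seq v n)))
      (0≤-+ (affine (ℤ.- s) 1ℤ (ℤ.- c) (x , y) + affine s -1ℤ c (u , v)) (fromℚ (ι s) * (x - u))
        (0≤-+ (affine (ℤ.- s) 1ℤ (ℤ.- c) (x , y)) (affine s -1ℤ c (u , v)) h k)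
        (0≤-scaled-difference s x u x≈u))
    where
    open ℚ-Solver
    identity : ∀ s c x y u v → ((ℚ.- s) ℚ.* x ℚ.+ 1ℚ ℚ.* y ℚ.+ (ℚ.- c)) ℚ.+ (s ℚ.* u ℚ.+ ι -1ℤ ℚ.* v ℚ.+ c)
                               ℚ.+ s ℚ.* (x ℚ.- u) ≡ y ℚ.- v
    identity = solve 6 (λ s c x y u v →
      ((:- s) :* x :+ con 1ℚ :* y :+ (:- c)) :+ (s :* u :+ con (ι -1ℤ) :* v :+ c) :+ s :* (x :- u)
        := y :- v) refl

-- Segments and their unions

record Segment : Set where
  constructor segment
  field
    slope intercept left right : ℤ

open Segment

record On (g : Segment) (z : ℝ²) : Set where
  field
    line     : OnLine (slope g) (intercept g) z
    right-of : HalfPlane 1ℤ 0ℤ (ℤ.- left g) z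
    left-of  : HalfPlane -1ℤ 0ℤ (right g) z

open On

onLine-point : ∀ {s c} x y → y ≡ s ℤ.* x ℤ.+ c → OnLine s c (point x y)
onLine-point {s} {c} x y refl = onLine
  (halfPlane-point s -1ℤ c x y (ℤ.≤-reflexive
    (solve 3 (λ s x c → con 0ℤ := s :* x :+ con -1ℤ :* (s :* x :+ c) :+ c) refl s x c)))
  (halfPlane-point (ℤ.- s) 1ℤ (ℤ.- c) x y (ℤ.≤-reflexive
    (solve 3 (λ s x c → con 0ℤ := (:- s) :* x :+ con 1ℤ :* (s :* x :+ c) :+ (:- c)) refl s x c)))
  where open ℤ-Solver

on-point : ∀ {g} x y → y ≡ slope g ℤ.* x ℤ.+ intercept g →
           left g ℤ.≤ x → x ℤ.≤ right g → On g (point x y)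
on-point {g} x y eq l≤x x≤r = record
  { line     = onLine-point x y eq
  ; right-of = halfPlane-point 1ℤ 0ℤ (ℤ.- left g) x y (subst (0ℤ ℤ.≤_)
      (solve 3 (λ x y l → x :- l := con 1ℤ :* x :+ con 0ℤ :* y :+ (:- l)) refl x y (left g))
      (ℤ.i≤j⇒0≤j-i l≤x))
  ; left-of  = halfPlane-point -1ℤ 0ℤ (right g) x y (subst (0ℤ ℤ.≤_)
      (solve 3 (λ x y r → r :- x := con -1ℤ :* x :+ con 0ℤ :* y :+ r) refl x y (right g))
      (ℤ.i≤j⇒0≤j-i x≤r))
  }
  where open ℤ-Solver

on-resp : ∀ {g} → On g Respects _≈²_
on-resp {g} {z} {w} z≈w o = record
  { line     = onLine (halfPlane-resp {x = z} {w} z≈w (OnLine.below (line o)))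
                      (halfPlane-resp {x = z} {w} z≈w (OnLine.above (line o)))
  ; right-of = halfPlane-resp {x = z} {w} z≈w (right-of o)
  ; left-of  = halfPlane-resp {x = z} {w} z≈w (left-of o)
  }

on-convex : ∀ {g p q} → On g p → On g q → [ p ⟷ q ] ⊆ On g
on-convex {g} {p} {q} o o′ {z} z∈ = record
  { line     = onLine (halfPlane-convex {p = p} {q} (OnLine.below (line o)) (OnLine.below (line o′)) {z} z∈)
                      (halfPlane-convex {p = p} {q} (OnLine.above (line o)) (OnLine.above (line o′)) {z} z∈)
  ; right-of = halfPlane-convex {p = p} {q} (right-of o) (right-of o′) {z} z∈
  ; left-of  = halfPlane-convex {p = p} {q} (left-of o) (left-of o′) {z} z∈
  }

-- Closed conditions pass to the limit `p`. Each of the two affine functions defining the line is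
-- then zero at `p` and nonnegative at further sample points, hence nonnegative at `q`. The segment
-- may end before `q`, so only its line is claimed to contain `q`.
on-frequently : ∀ {g p q} → Frequently (λ N → On g (sample p q N)) →
                On g p × OnLine (slope g) (intercept g) q
on-frequently {g} {p} {q} freq =
  record
    { line     = onLine on-below on-above
    ; right-of = halfPlane-closed {p = p} {q} (frequently-map right-of freq)
    ; left-of  = halfPlane-closed {p = p} {q} (frequently-map left-of freq)
    } ,
  onLine
    (halfPlane-far {p = p} {q} on-above below-freq)
    (halfPlane-far {p = p} {q}
      (halfPlane-cong (sym (ℤ.neg-involutive (slope g))) refl (sym (ℤ.neg-involutive (intercept g))) on-below)
      above-freq)
  where
  below-freq : Frequently (λ N → HalfPlane (slope g) -1ℤ (intercept g) (sample p q N))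
  below-freq = frequently-map (λ o → OnLine.below (line o)) freq
  above-freq : Frequently (λ N → HalfPlane (ℤ.- slope g) 1ℤ (ℤ.- intercept g) (sample p q N))
  above-freq = frequently-map (λ o → OnLine.above (line o)) freq
  on-below : HalfPlane (slope g) -1ℤ (intercept g) p
  on-below = halfPlane-closed {p = p} {q} below-freq
  on-above : HalfPlane (ℤ.- slope g) 1ℤ (ℤ.- intercept g) p
  on-above = halfPlane-closed {p = p} {q} above-freq

Eventually : Pred ℕ 0ℓ → Set
Eventually P = ∃[ M ] (∀ N → M ≤ℕ N → P N)

-- Abstract form of finitely many segments on pairwise different lines. Finiteness enters through
-- `¬¬-bound`: thresholds for the single tags merge into a common one, under a double negation.
module Union
  {Tag : Set} (Valid : Pred Tag 0ℓ) (seg : Tag → Segment)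
  (seg-injective : ∀ g h → slope (seg g) ≡ slope (seg h) →
                   intercept (seg g) ≡ intercept (seg h) → g ≡ h)
  (¬¬-bound : ∀ (P : Tag → Pred ℕ 0ℓ) → (∀ g → Valid g → ¬ ¬ Eventually (P g)) →
              ¬ ¬ Eventually (λ N → ∀ g → Valid g → P g N))
  where

  ⋃ : Pred ℝ² 0ℓ
  ⋃ z = ∃[ g ] (Valid g × On (seg g) z)

  ⋃-resp : ⋃ Respects _≈²_
  ⋃-resp {z} {w} z≈w (g , v , o) = g , v , on-resp {seg g} {z} {w} z≈w o

  -- If no segment contained sample points arbitrarily close to `p`, each would be missed from some
  -- index on, hence all of them from a common index on; but the sample point with that index lies
  -- in the union.
  initial-segment : ∀ p q → [ p ⟷ q ] ⊆ ⋃ →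
    ¬ ¬ (∃[ g ] (Valid g × On (seg g) p × OnLine (slope (seg g)) (intercept (seg g)) q))
  initial-segment p q pq⊆⋃ none = ¬¬-bound (λ g N → ¬ On (seg g) (sample p q N))
    (λ g v ¬never → none (g , v , on-frequently {seg g} {p} {q} (λ M never → ¬never (M , never))))
    (λ (M , never) →
      let g , v , o = pq⊆⋃ {sample p q M} (sample∈segment p q M)
      in never M ℕ.≤-refl g v o)

  -- The segments met near the two ends of [p ⟷ q] both span the line pq, so
  -- they coincide unless p ≈² q.
  common-segment : ∀ p q → [ p ⟷ q ] ⊆ ⋃ → ¬ ¬ (∃[ g ] (Valid g × On (seg g) p × On (seg g) q))
  common-segment p q pq⊆⋃ none =
    initial-segment p q pq⊆⋃ λ (g , v , gp , gq) →
    initial-segment q p (λ {z} z∈ → pq⊆⋃ {z} (segment-sym p q {z} z∈)) λ (h , w , hq , hp) →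
    none (g , v , gp , decide g h gp gq hq hp)
    where
    decide : ∀ g h → On (seg g) p → OnLine (slope (seg g)) (intercept (seg g)) q →
             On (seg h) q → OnLine (slope (seg h)) (intercept (seg h)) p → On (seg g) q
    decide g h gp gq hq hp with slope (seg g) ℤ.≟ slope (seg h)
    ... | yes s≡s′ = subst (λ g → On (seg g) q) (sym g≡h) hq
      where
      g≡h = seg-injective g h s≡s′ (parallel {z = q} gq
        (subst (λ s → OnLine s (intercept (seg h)) q) (sym s≡s′) (line hq)))
    ... | no  s≢s′ = on-resp {seg g} {p} {q}
      (lines-meet-once {p = p} {q = q} s≢s′ (line gp) hp gq (line hq)) gp

-- The construction

data Tag : Set where
  axis      : Tag
  legˡ legʳ : (j : ℕ) → Tag
  arm       : (i m : ℕ) → Tag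

-- Finiteness under double negation, and a pigeonhole argument

eventually-× : ∀ {P Q : Pred ℕ 0ℓ} → Eventually P → Eventually Q → Eventually (λ N → P N × Q N)
eventually-× (K , p) (L , q) = K ℕ.⊔ L ,
  λ N b → p N (ℕ.m⊔n≤o⇒m≤o K L b) , q N (ℕ.m⊔n≤o⇒n≤o K L b)

¬¬-eventually-≤ : ∀ b (Q : ℕ → Pred ℕ 0ℓ) → (∀ j → j ≤ℕ b → ¬ ¬ Eventually (Q j)) →
                  ¬ ¬ Eventually (λ N → ∀ j → j ≤ℕ b → Q j N)
¬¬-eventually-≤ zero Q h none = h 0 ℕ.z≤n λ (M , q) → none (M , λ { N b .0 ℕ.z≤n → q N b })
¬¬-eventually-≤ (suc b) Q h none =
  ¬¬-eventually-≤ b Q (λ j j≤b → h j (ℕ.m≤n⇒m≤1+n j≤b)) λ ev →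
  h (suc b) ℕ.≤-refl λ ev′ →
  let M , q = eventually-× ev ev′
  in none (M , λ N M≤N j j≤ → extend (q N M≤N) j (ℕ.m≤n⇒m<n∨m≡n j≤))
  where
  extend : ∀ {N} → (∀ j → j ≤ℕ b → Q j N) × Q (suc b) N →
           ∀ j → j ℕ.< suc b ⊎ j ≡ suc b → Q j N
  extend (q , _) j (inj₁ j<) = q j (ℕ.s≤s⁻¹ j<)
  extend (_ , q) _ (inj₂ refl) = q

-- If every value were hit, choosing preimages would inject `Fin (suc k)` into `Fin k`.
missed-value : ∀ {k} (f : Fin k → Fin (suc k)) → ∃[ j ] (∀ r → f r ≢ j)
missed-value {k} f =
  let j , unhit = Fin.¬∀⟶∃¬ (suc k) (λ j → ∃[ r ] f r ≡ j)
                    (λ j → Fin.any? (λ r → f r Fin.≟ j)) not-surjective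
  in j , λ r fr≡j → unhit (r , fr≡j)
  where
  not-surjective : ¬ (∀ j → ∃[ r ] f r ≡ j)
  not-surjective onto =
    let i , j , i<j , eq = Fin.pigeonhole (ℕ.n<1+n k) (λ j → proj₁ (onto j))
    in Fin.<⇒≢ i<j (trans (sym (proj₂ (onto i))) (trans (cong f eq) (proj₂ (onto j))))

left≤right : ∀ g h z → On g z → On h z → left g ℤ.≤ right h
left≤right g h z og oh = ℤ.0≤i-j⇒j≤i (halfPlane-const⁻¹ {z = z}
  (halfPlane-cong refl refl (ℤ.+-comm (ℤ.- left g) (right h)) (halfPlane-+ (right-of og) (left-of oh))))

+≰-[1+] : ∀ m n → ¬ + m ℤ.≤ -[1+ n ]
+≰-[1+] _ _ ()

module Construction (k n : ℕ) where
  open ℤ-Solver using (solve; _:=_; _:+_; _:-_; _:*_; :-_; con)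

  Valid : Pred Tag 0ℓ
  Valid axis      = ⊤
  Valid (legˡ j)  = j ≤ℕ k
  Valid (legʳ j)  = j ≤ℕ k
  Valid (arm i m) = i ≤ℕ k × m ≤ℕ n

  -- Chosen so that arm i m and arm i (suc m) meet where x = -(2k + 1 + m).
  descent : ℕ → ℕ
  descent zero    = 0
  descent (suc m) = descent m ℕ.+ suc (k ℕ.+ k ℕ.+ m)

  -- The horizontal segment of arm `i` has height `-(1 + i)`, which the line of right leg `j`
  -- reaches at abscissa `1 + i + 3j`. This is at most `4i` exactly when `j < i`.
  arm-right : ℕ → ℕ → ℤ
  arm-right i zero    = + (4 ℕ.* i)
  arm-right i (suc m) = -[1+ k ℕ.+ k ℕ.+ m ]

  seg : Tag → Segment
  seg axis      = segment (+ 2) 0ℤ 0ℤ (+ k)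
  -- The lower end has height `-j`, so the leg comes down to the height `-(1 + i)` of arm `i`
  -- exactly when `i < j`.
  seg (legˡ j)  = segment 1ℤ (+ j) (ℤ.- + (2 ℕ.* j)) (+ j)
  seg (legʳ j)  = segment -1ℤ (+ (3 ℕ.* j)) (+ j) (+ (4 ℕ.* k))
  seg (arm i m) = segment (ℤ.- + m) -[1+ i ℕ.+ descent m ] -[1+ k ℕ.+ k ℕ.+ m ] (arm-right i m)

  -- The slope separates the axis from everything else and left legs from right ones; arms have
  -- negative intercepts, legs do not. Within one kind, slope and intercept determine the indices.
  seg-injective : ∀ g h → slope (seg g) ≡ slope (seg h) →
                  intercept (seg g) ≡ intercept (seg h) → g ≡ h
  seg-injective axis axis _ _ = refl
  seg-injective axis (legˡ _) () _
  seg-injective axis (legʳ _) () _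
  seg-injective axis (arm _ zero) () _
  seg-injective axis (arm _ (suc _)) () _
  seg-injective (legˡ _) axis () _
  seg-injective (legˡ _) (legˡ _) _ refl = refl
  seg-injective (legˡ _) (legʳ _) () _
  seg-injective (legˡ _) (arm _ _) _ ()
  seg-injective (legʳ _) axis () _
  seg-injective (legʳ _) (legˡ _) () _
  seg-injective (legʳ i) (legʳ j) _ eq = cong legʳ (ℕ.*-cancelˡ-≡ i j 3 (ℤ.+-injective eq))
  seg-injective (legʳ _) (arm _ _) _ ()
  seg-injective (arm _ zero) axis () _
  seg-injective (arm _ (suc _)) axis () _
  seg-injective (arm _ _) (legˡ _) _ ()
  seg-injective (arm _ _) (legʳ _) _ ()
  seg-injective (arm i m) (arm i′ m′) s≡ c≡ with ℤ.+-injective (ℤ.neg-injective s≡)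
  ... | refl = cong (λ i → arm i m) (ℕ.+-cancelʳ-≡ (descent m) i i′ (ℤ.-[1+-injective c≡))

  ¬¬-bound : ∀ (P : Tag → Pred ℕ 0ℓ) → (∀ g → Valid g → ¬ ¬ Eventually (P g)) →
             ¬ ¬ Eventually (λ N → ∀ g → Valid g → P g N)
  ¬¬-bound P h none =
    h axis tt λ e₁ →
    ¬¬-eventually-≤ k (λ j → P (legˡ j)) (λ j → h (legˡ j)) λ e₂ →
    ¬¬-eventually-≤ k (λ j → P (legʳ j)) (λ j → h (legʳ j)) λ e₃ →
    ¬¬-eventually-≤ k (λ i N → ∀ m → m ≤ℕ n → P (arm i m) N)
      (λ i i≤k → ¬¬-eventually-≤ n (λ m → P (arm i m)) (λ m m≤n → h (arm i m) (i≤k , m≤n))) λ e₄ →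
    let M , e = eventually-× (eventually-× e₁ e₂) (eventually-× e₃ e₄)
    in none (M , λ N b → collect (e N b))
    where
    collect : ∀ {N} → (P axis N × (∀ j → j ≤ℕ k → P (legˡ j) N)) ×
              ((∀ j → j ≤ℕ k → P (legʳ j) N) × (∀ i → i ≤ℕ k → ∀ m → m ≤ℕ n → P (arm i m) N)) →
              ∀ g → Valid g → P g N
    collect ((p , _) , _ , _) axis      _           = p
    collect ((_ , p) , _ , _) (legˡ j)  j≤k         = p j j≤k
    collect ((_ , _) , p , _) (legʳ j)  j≤k         = p j j≤k
    collect ((_ , _) , _ , p) (arm i m) (i≤k , m≤n) = p i i≤k m m≤n

  open Union Valid seg seg-injective ¬¬-bound

  -- Which segments meet an arm

  data Adjacent (i m : ℕ) : Tag → Set where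
    to-legˡ : ∀ {j} → m ≡ 0 → i ℕ.< j → Adjacent i m (legˡ j)
    to-legʳ : ∀ {j} → m ≡ 0 → j ℕ.< i → Adjacent i m (legʳ j)
    -- A one-sided bound: what will be counted is how fast a path can come down to segment 0, at
    -- most one index per link.
    to-arm  : ∀ {m′} → m ≤ℕ suc m′ → Adjacent i m (arm i m′)

  OnTag : Tag → Pred ℝ² 0ℓ
  OnTag g = On (seg g)

  -- The first segment lies to the right of `x = -(1 + 2k + m)` and the second to its left, so a
  -- common point has this abscissa; there the heights of the two segments differ by `i′ - i`.
  consecutive-arms : ∀ i i′ m z → OnTag (arm i m) z → OnTag (arm i′ (suc m)) z → i ≡ i′
  consecutive-arms i i′ m z o o′ = ℕ.≤-antisym
    (bound (solve 4 (λ I I′ D K → (((:- (con 1ℤ :+ (I :+ D))) :- (:- (con 1ℤ :+ (I′ :+ (D :+ (con 1ℤ :+ K))))))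
               :+ (:- (con 1ℤ :+ K))) := I′ :- I) refl (+ i) (+ i′) (+ descent m) (+ (k ℕ.+ k ℕ.+ m)))
      (halfPlane-cong
        (solve 1 (λ M → ((:- M) :- (:- (con 1ℤ :+ M))) :+ con -1ℤ := con 0ℤ) refl (+ m)) refl refl
        (halfPlane-+ (crossing (line o) (line o′)) (left-of o′))))
    (bound (solve 4 (λ I I′ D K → (((:- (con 1ℤ :+ (I′ :+ (D :+ (con 1ℤ :+ K))))) :- (:- (con 1ℤ :+ (I :+ D))))
               :+ (con 1ℤ :+ K)) := I :- I′) refl (+ i) (+ i′) (+ descent m) (+ (k ℕ.+ k ℕ.+ m)))
      (halfPlane-cong
        (solve 1 (λ M → ((:- (con 1ℤ :+ M)) :- (:- M)) :+ con 1ℤ := con 0ℤ) refl (+ m)) refl refl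
        (halfPlane-+ (crossing (line o′) (line o)) (right-of o))))
    where
    bound : ∀ {c a b} → c ≡ + b ℤ.- + a → HalfPlane 0ℤ 0ℤ c z → a ≤ℕ b
    bound refl h = ℤ.drop‿+≤+ (ℤ.0≤i-j⇒j≤i (halfPlane-const⁻¹ {z = z} h))

  arms-overlap : ∀ i i′ m m′ z → OnTag (arm i m) z → OnTag (arm i′ (suc m′)) z → m′ ≤ℕ m
  arms-overlap i i′ m m′ z o o′ =
    ℕ.+-cancelˡ-≤ (k ℕ.+ k) m′ m (ℤ.drop‿-≤- (left≤right (seg (arm i m)) (seg (arm i′ (suc m′))) z o o′))

  axis-misses-arm : ∀ i m z → OnTag axis z → ¬ OnTag (arm i m) z
  axis-misses-arm i zero z o o′ = +≰-[1+] 0 i (halfPlane-const⁻¹ {z = z}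
    (halfPlane-cong refl refl
      (solve 1 (λ I → (:- (con 1ℤ :+ (I :+ con 0ℤ)) :- con 0ℤ) :+ con 0ℤ :+ con 0ℤ
                      := :- (con 1ℤ :+ I)) refl (+ i))
      (halfPlane-+ (halfPlane-+ (crossing (line o′) (line o)) (right-of o)) (right-of o))))
  axis-misses-arm i (suc m) z o o′ =
    +≰-[1+] 0 (k ℕ.+ k ℕ.+ m) (left≤right (seg axis) (seg (arm i (suc m))) z o o′)

  -- On segment 0 the crossing is at `x = -(1 + i + j)`, and `-2j ≤ x` means `i < j`. Later segments
  -- lie to the left of `-2k`, beyond every left leg.
  legˡ-meets-arm : ∀ i m j z → j ≤ℕ k → OnTag (legˡ j) z → OnTag (arm i m) z → m ≡ 0 × i ℕ.< j
  legˡ-meets-arm i zero j z _ o o′ = refl , ℤ.drop‿+≤+ (ℤ.0≤i-j⇒j≤i (halfPlane-const⁻¹ {z = z}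
    (halfPlane-cong refl refl
      (solve 2 (λ I J → (:- (con 1ℤ :+ (I :+ con 0ℤ)) :- J) :+ :- (:- (J :+ (J :+ con 0ℤ)))
                        := J :- (con 1ℤ :+ I)) refl (+ i) (+ j))
      (halfPlane-+ (crossing (line o′) (line o)) (right-of o)))))
  legˡ-meets-arm i (suc m) j z j≤k o o′ = contradiction
    (ℕ.≤-trans
      (ℤ.drop‿+≤+ (ℤ.neg-cancel-≤ {i = + (2 ℕ.* j)} {j = + suc (k ℕ.+ k ℕ.+ m)}
        (left≤right (seg (legˡ j)) (seg (arm i (suc m))) z o o′)))
      (ℕ.+-mono-≤ j≤k (ℕ.≤-trans (ℕ.≤-reflexive (ℕ.+-identityʳ j)) j≤k)))
    (ℕ.<⇒≱ (ℕ.s≤s (ℕ.m≤m+n (k ℕ.+ k) m)))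

  -- On segment 0, `1 + i + 3j = x ≤ 4i` excludes `i ≤ j`. Later segments have negative abscissae.
  legʳ-meets-arm : ∀ i m j z → OnTag (legʳ j) z → OnTag (arm i m) z → m ≡ 0 × j ℕ.< i
  legʳ-meets-arm i zero j z o o′ = refl , ℕ.≰⇒> λ i≤j →
    ℕ.<⇒≱ (ℕ.s≤s (ℕ.+-monoʳ-≤ i (ℕ.*-monoʳ-≤ 3 i≤j))) (ℤ.drop‿+≤+ (ℤ.0≤i-j⇒j≤i (halfPlane-const⁻¹ {z = z}
      (halfPlane-cong refl refl
        (solve 3 (λ I J Q → (:- (con 1ℤ :+ (I :+ con 0ℤ)) :- J) :+ Q := Q :- (con 1ℤ :+ (I :+ J)))
          refl (+ i) (+ (3 ℕ.* j)) (+ (4 ℕ.* i)))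
        (halfPlane-+ (crossing (line o′) (line o)) (left-of o′))))))
  legʳ-meets-arm i (suc m) j z o o′ = contradiction
    (left≤right (seg (legʳ j)) (seg (arm i (suc m))) z o o′) (+≰-[1+] j (k ℕ.+ k ℕ.+ m))

  arm-meets-later-arm : ∀ i i′ m m′ z → m ℕ.< m′ → OnTag (arm i m) z → OnTag (arm i′ m′) z →
                        i ≡ i′ × m′ ≡ suc m
  arm-meets-later-arm i i′ m (suc m′) z m<m′ o o′ =
    consecutive-arms i i′ m z o (subst (λ l → OnTag (arm i′ (suc l)) z) m′≡m o′) , cong suc m′≡m
    where
    m′≡m : m′ ≡ m
    m′≡m = ℕ.≤-antisym (arms-overlap i i′ m m′ z o o′) (ℕ.s≤s⁻¹ m<m′)

  -- For `m = m′` the lines are parallel, so their intercepts agree. Otherwise overlapping abscissae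
  -- make the segments consecutive, and their common abscissa determines the arm.
  arms-meet : ∀ i i′ m m′ z → OnTag (arm i m) z → OnTag (arm i′ m′) z → i ≡ i′ × m ≤ℕ suc m′
  arms-meet i i′ m m′ z o o′ = cases (ℕ.<-cmp m m′)
    where
    cases : Tri (m ℕ.< m′) (m ≡ m′) (m′ ℕ.< m) → i ≡ i′ × m ≤ℕ suc m′
    cases (tri< m<m′ _ _) =
      proj₁ (arm-meets-later-arm i i′ m m′ z m<m′ o o′) , ℕ.m≤n⇒m≤1+n (ℕ.<⇒≤ m<m′)
    cases (tri≈ _ refl _) =
      ℕ.+-cancelʳ-≡ (descent m) i i′ (ℤ.-[1+-injective (parallel {z = z} (line o) (line o′))) , ℕ.n≤1+n m
    cases (tri> _ _ m′<m) =
      let i′≡i , m≡ = arm-meets-later-arm i′ i m′ m z m′<m o′ o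
      in sym i′≡i , ℕ.≤-reflexive m≡

  adjacent : ∀ i m g z → Valid g → OnTag g z → OnTag (arm i m) z → Adjacent i m g
  adjacent i m axis     z _ o o′ = contradiction o′ (axis-misses-arm i m z o)
  adjacent i m (legˡ j) z v o o′ = let m≡0 , i<j = legˡ-meets-arm i m j z v o o′ in to-legˡ m≡0 i<j
  adjacent i m (legʳ j) z _ o o′ = let m≡0 , j<i = legʳ-meets-arm i m j z o o′ in to-legʳ m≡0 j<i
  adjacent i m (arm i′ m′) z _ o o′ =
    let i≡i′ , m≤ = arms-meet i i′ m m′ z o′ o
    in subst (λ l → Adjacent i m (arm l m′)) i≡i′ (to-arm m≤)

  -- Vertices, corners, and the legs joining vertices to arms

  vertex : ℕ → ℝ²
  vertex j = point (+ j) (+ (2 ℕ.* j))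

  vertex-on-axis : ∀ j → j ≤ℕ k → OnTag axis (vertex j)
  vertex-on-axis j j≤k = on-point {seg axis} (+ j) (+ (2 ℕ.* j))
    (trans (ℤ.pos-* 2 j) (sym (ℤ.+-identityʳ _)))
    (ℤ.+≤+ ℕ.z≤n) (ℤ.+≤+ j≤k)

  vertex-on-legˡ : ∀ j → OnTag (legˡ j) (vertex j)
  vertex-on-legˡ j = on-point {seg (legˡ j)} (+ j) (+ (2 ℕ.* j))
    (solve 1 (λ J → J :+ (J :+ con 0ℤ) := con 1ℤ :* J :+ J) refl (+ j))
    ℤ.neg-≤-pos ℤ.≤-refl

  vertex-on-legʳ : ∀ j → j ≤ℕ k → OnTag (legʳ j) (vertex j)
  vertex-on-legʳ j j≤k = on-point {seg (legʳ j)} (+ j) (+ (2 ℕ.* j))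
    (solve 1 (λ J → J :+ (J :+ con 0ℤ) := con -1ℤ :* J :+ (J :+ (J :+ (J :+ con 0ℤ)))) refl (+ j))
    ℤ.≤-refl (ℤ.+≤+ (ℕ.m≤n⇒m≤n+o (3 ℕ.* k) j≤k))

  -- For `m < n` this is a bend of the arm, for `m = n` its far end. The far end also lies on
  -- `arm i (suc n)`, which is not a valid tag but serves as the start of the count in `Near`.
  corner : ℕ → ℕ → ℝ²
  corner i m = point x (ℤ.- + m ℤ.* x ℤ.+ -[1+ i ℕ.+ descent m ])
    where x = -[1+ k ℕ.+ k ℕ.+ m ]

  corner-on-arm : ∀ i m → OnTag (arm i m) (corner i m)
  corner-on-arm i m = on-point {seg (arm i m)} -[1+ k ℕ.+ k ℕ.+ m ] _ refl ℤ.≤-refl (≤right m)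
    where
    ≤right : ∀ m → -[1+ k ℕ.+ k ℕ.+ m ] ℤ.≤ arm-right i m
    ≤right zero    = ℤ.-≤+
    ≤right (suc m) = ℤ.-≤- (ℕ.+-monoʳ-≤ (k ℕ.+ k) (ℕ.n≤1+n m))

  corner-on-next-arm : ∀ i m → OnTag (arm i (suc m)) (corner i m)
  corner-on-next-arm i m = on-point {seg (arm i (suc m))} -[1+ k ℕ.+ k ℕ.+ m ] _
    (solve 4 (λ M I D K →
       (:- M) :* (:- (con 1ℤ :+ K)) :+ (:- (con 1ℤ :+ (I :+ D)))
         := (:- (con 1ℤ :+ M)) :* (:- (con 1ℤ :+ K)) :+ (:- (con 1ℤ :+ (I :+ (D :+ (con 1ℤ :+ K))))))
       refl (+ m) (+ i) (+ descent m) (+ (k ℕ.+ k ℕ.+ m)))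
    (ℤ.-≤- (ℕ.+-monoʳ-≤ (k ℕ.+ k) (ℕ.n≤1+n m))) ℤ.≤-refl

  corner-injective : ∀ i i′ m → corner i m ≈² corner i′ m → i ≡ i′
  corner-injective i i′ m eq = proj₁ (arms-meet i i′ m m (corner i′ m)
    (on-resp {seg (arm i m)} {corner i m} {corner i′ m} eq (corner-on-arm i m)) (corner-on-arm i′ m))

  corners-distinct : ∀ i {m m′} → m ℕ.< m′ → ¬ corner i m ≈² corner i m′
  corners-distinct i {m} {m′} m<m′ eq = ℕ.<⇒≱ m<m′
    (arms-overlap i i m m′ (corner i m) (corner-on-arm i m)
      (on-resp {seg (arm i (suc m′))} {corner i m′} {corner i m}
        (≈-sym {proj₁ (corner i m)} {proj₁ (corner i m′)} (proj₁ eq) ,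
         ≈-sym {proj₂ (corner i m)} {proj₂ (corner i m′)} (proj₂ eq))
        (corner-on-next-arm i m′)))

  -- One link along a leg from vertex `j` to arm `i`. The foot precedes the corners in a list of
  -- intermediate points that must be distinct, hence `foot≉corner`.
  record Route (j i : ℕ) : Set where
    field
      leg       : Tag
      valid     : Valid leg
      foot      : ℝ²
      from-vertex : OnTag leg (vertex j)
      foot-on-leg : OnTag leg foot
      foot-on-arm : OnTag (arm i 0) foot
      foot≉corner : ∀ m → ¬ foot ≈² corner i m

  route : ∀ j i → j ≤ℕ k → i ≤ℕ k → i ≢ j → Route j i
  route j i j≤k i≤k i≢j = cases (ℕ.<-cmp i j)
    where
    foot-distinct : ∀ g z → Valid g → (∀ m → ¬ Adjacent i (suc m) g) → OnTag g z →
                    ∀ m → ¬ z ≈² corner i m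
    foot-distinct g z v ¬adj o m eq = ¬adj m (adjacent i (suc m) g (corner i m) v
      (on-resp {seg g} {z} {corner i m} eq o) (corner-on-next-arm i m))
    cases : Tri (i ℕ.< j) (i ≡ j) (j ℕ.< i) → Route j i
    cases (tri< i<j _ _) = record
      { leg = legˡ j ; valid = j≤k ; foot = foot
      ; from-vertex = vertex-on-legˡ j
      ; foot-on-leg = on-leg
      ; foot-on-arm = on-point {seg (arm i 0)} -[1+ j ℕ.+ i ] -[1+ i ]
          (solve 2 (λ I X → :- (con 1ℤ :+ I) := con 0ℤ :* X :+ (:- (con 1ℤ :+ (I :+ con 0ℤ))))
            refl (+ i) -[1+ j ℕ.+ i ])
          (ℤ.-≤- (ℕ.≤-trans (ℕ.+-mono-≤ j≤k i≤k) (ℕ.m≤m+n (k ℕ.+ k) 0))) ℤ.-≤+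
      ; foot≉corner = foot-distinct (legˡ j) foot j≤k (λ { m (to-legˡ () _) }) on-leg
      }
      where
      foot : ℝ²
      -- The crossing of `y = x + j` with `y = -(1 + i)`.
      foot = point -[1+ j ℕ.+ i ] -[1+ i ]
      on-leg : OnTag (legˡ j) foot
      on-leg = on-point {seg (legˡ j)} -[1+ j ℕ.+ i ] -[1+ i ]
        (solve 2 (λ I J → :- (con 1ℤ :+ I) := con 1ℤ :* (:- (con 1ℤ :+ (J :+ I))) :+ J) refl (+ i) (+ j))
        (ℤ.neg-mono-≤ (ℤ.+≤+ 1+j+i≤2j))
        ℤ.-≤+
        where
        1+j+i≤2j : suc (j ℕ.+ i) ≤ℕ 2 ℕ.* j
        1+j+i≤2j = ℕ.≤-trans (ℕ.≤-reflexive (sym (ℕ.+-suc j i)))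
          (ℕ.+-monoʳ-≤ j (ℕ.≤-trans i<j (ℕ.m≤m+n j 0)))
    cases (tri≈ _ i≡j _) = contradiction i≡j i≢j
    cases (tri> _ _ j<i) = record
      { leg = legʳ j ; valid = j≤k ; foot = foot
      ; from-vertex = vertex-on-legʳ j j≤k
      ; foot-on-leg = on-leg
      ; foot-on-arm = on-point {seg (arm i 0)} (+ x) -[1+ i ]
          (solve 2 (λ I X → :- (con 1ℤ :+ I) := con 0ℤ :* X :+ (:- (con 1ℤ :+ (I :+ con 0ℤ))))
            refl (+ i) (+ x))
          ℤ.-≤+ (ℤ.+≤+ x≤4i)
      ; foot≉corner = foot-distinct (legʳ j) foot j≤k (λ { m (to-legʳ () _) }) on-leg
      }
      where
      x : ℕ
      -- The solution of `-x + 3j = -(1 + i)`.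
      x = suc i ℕ.+ 3 ℕ.* j
      foot : ℝ²
      foot = point (+ x) -[1+ i ]
      x≤4i : x ≤ℕ 4 ℕ.* i
      x≤4i = ℕ.≤-trans (ℕ.≤-reflexive (sym (ℕ.+-suc i (3 ℕ.* j))))
        (ℕ.+-monoʳ-≤ i (ℕ.*-monoʳ-< 3 j<i))
      on-leg : OnTag (legʳ j) foot
      on-leg = on-point {seg (legʳ j)} (+ x) -[1+ i ]
        (solve 2 (λ I J → :- (con 1ℤ :+ I) := con -1ℤ :* (con 1ℤ :+ (I :+ J)) :+ J) refl (+ i) (+ (3 ℕ.* j)))
        (ℤ.+≤+ (ℕ.m≤n⇒m≤o+n (suc i) (ℕ.m≤m+n j (2 ℕ.* j))))
        (ℤ.+≤+ (ℕ.≤-trans x≤4i (ℕ.*-monoʳ-≤ 4 i≤k)))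

  segment⊆⋃ : ∀ g → Valid g → ∀ {p q} → OnTag g p → OnTag g q → [ p ⟷ q ] ⊆ ⋃
  segment⊆⋃ g v {p} {q} o o′ {z} z∈ = g , v , on-convex {seg g} {p} {q} o o′ {z} z∈

  -- Any k points have a common viewpoint

  joints : ℕ → ℕ → ∀ l → Vec ℝ² l
  joints i m zero    = []
  joints i m (suc l) = corner i m ∷ joints i (suc m) l

  joints⊆⋃ : ∀ i m l x y → i ≤ℕ k → l ℕ.+ m ≤ℕ n → OnTag (arm i m) x → OnTag (arm i (l ℕ.+ m)) y →
             polygonalPath x (joints i m l) y ⊆ ⋃
  joints⊆⋃ i m zero    x y i≤k m≤n ox oy {z} z∈ =
    segment⊆⋃ (arm i m) (i≤k , m≤n) {x} {y} ox oy {z} z∈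
  joints⊆⋃ i m (suc l) x y i≤k b   ox oy {z} (inj₁ z∈) =
    segment⊆⋃ (arm i m) (i≤k , ℕ.m+n≤o⇒n≤o (suc l) b) {x} {corner i m} ox (corner-on-arm i m) {z} z∈
  joints⊆⋃ i m (suc l) x y i≤k b   ox oy {z} (inj₂ z∈) =
    joints⊆⋃ i (suc m) l (corner i m) y i≤k
      (ℕ.≤-trans (ℕ.≤-reflexive (ℕ.+-suc l m)) b) (corner-on-next-arm i m)
      (subst (λ r → OnTag (arm i r) y) (sym (ℕ.+-suc l m)) oy) {z} z∈

  joints-avoid : ∀ i x m l → (∀ r → m ≤ℕ r → ¬ x ≈² corner i r) → All (λ v → ¬ x ≈² v) (joints i m l)
  joints-avoid i x m zero    h = []
  joints-avoid i x m (suc l) h = h m ℕ.≤-refl ∷ joints-avoid i x (suc m) l (λ r m<r → h r (ℕ.<⇒≤ m<r))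

  joints-unique : ∀ i m l → Unique (joints i m l)
  joints-unique i m zero    = []
  joints-unique i m (suc l) =
    joints-avoid i (corner i m) (suc m) l (λ r → corners-distinct i) ∷ joints-unique i (suc m) l

  -- The index of the vertex to be avoided. Axis and legs are seen from every vertex, so their
  -- default 0 merely excludes a vertex that would also do.
  home : Tag → ℕ
  home axis      = 0
  home (legˡ _)  = 0
  home (legʳ _)  = 0
  home (arm i _) = i

  visible : ∀ g p j → Valid g → OnTag g p → j ≤ℕ k → home g ≢ j →
            VisibleWithin (suc (suc n)) ⋃ (vertex j) p
  visible axis p j v o j≤k _ =
    1 , _ , ℕ.s≤s ℕ.z≤n , [] , [] , λ {z} → segment⊆⋃ axis v {vertex j} {p} (vertex-on-axis j j≤k) o {z}
  visible (legˡ l) p j l≤k o j≤k _ =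
    2 , _ , ℕ.s≤s (ℕ.s≤s ℕ.z≤n) , vertex l ∷ [] , [] ∷ [] , λ
      { {z} (inj₁ z∈) → segment⊆⋃ axis tt {vertex j} {vertex l} (vertex-on-axis j j≤k) (vertex-on-axis l l≤k) {z} z∈
      ; {z} (inj₂ z∈) → segment⊆⋃ (legˡ l) l≤k {vertex l} {p} (vertex-on-legˡ l) o {z} z∈ }
  visible (legʳ l) p j l≤k o j≤k _ =
    2 , _ , ℕ.s≤s (ℕ.s≤s ℕ.z≤n) , vertex l ∷ [] , [] ∷ [] , λ
      { {z} (inj₁ z∈) → segment⊆⋃ axis tt {vertex j} {vertex l} (vertex-on-axis j j≤k) (vertex-on-axis l l≤k) {z} z∈
      ; {z} (inj₂ z∈) → segment⊆⋃ (legʳ l) l≤k {vertex l} {p} (vertex-on-legʳ l l≤k) o {z} z∈ }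
  visible (arm i m) p j (i≤k , m≤n) o j≤k i≢j =
    -- One link along the leg and one on each of the segments 0 to `m` of the arm.
    suc (suc m) , _ , ℕ.s≤s (ℕ.s≤s m≤n) , foot ∷ joints i 0 m ,
    joints-avoid i foot 0 m (λ r _ → foot≉corner r) ∷ joints-unique i 0 m , λ
      { {z} (inj₁ z∈) → segment⊆⋃ leg valid {vertex j} {foot} from-vertex foot-on-leg {z} z∈
      ; {z} (inj₂ z∈) → joints⊆⋃ i 0 m foot p i≤k
          (ℕ.≤-trans (ℕ.≤-reflexive (ℕ.+-identityʳ m)) m≤n) foot-on-arm
          (subst (λ r → OnTag (arm i r) p) (sym (ℕ.+-identityʳ m)) o) {z} z∈ }
    where open Route (route j i j≤k i≤k i≢j)

  common-viewpoint : (p : Fin k → ℝ²) → (∀ r → p r ∈ ⋃) → HasCommonViewpoint (suc (suc n)) ⋃ p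
  common-viewpoint p p∈⋃ = vertex j , (axis , tt , vertex-on-axis j j≤k) , λ r →
    visible (tag r) (p r) j (valid r) (proj₂ (proj₂ (p∈⋃ r))) j≤k λ eq →
      proj₂ missed r (Fin.toℕ-injective (trans (Fin.toℕ-fromℕ< (home< r)) eq))
    where
    tag : Fin k → Tag
    tag r = proj₁ (p∈⋃ r)
    valid : ∀ r → Valid (tag r)
    valid r = proj₁ (proj₂ (p∈⋃ r))
    home≤k : ∀ g → Valid g → home g ≤ℕ k
    home≤k axis      _         = ℕ.z≤n
    home≤k (legˡ _)  _         = ℕ.z≤n
    home≤k (legʳ _)  _         = ℕ.z≤n
    home≤k (arm _ _) (i≤k , _) = i≤k
    home< : ∀ r → home (tag r) ℕ.< suc k
    home< r = ℕ.s≤s (home≤k (tag r) (valid r))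
    -- The `k` points have at most `k` homes among `k + 1` indices.
    missed : ∃[ j ] (∀ r → fromℕ< (home< r) ≢ j)
    missed = missed-value (λ r → fromℕ< (home< r))
    j = toℕ (proj₁ missed)
    j≤k : j ≤ℕ k
    j≤k = ℕ.s≤s⁻¹ (Fin.toℕ<n (proj₁ missed))

  -- The far ends of the arms have no common viewpoint

  data Final (i : ℕ) : Tag → Set where
    at-legˡ : ∀ {j} → i ℕ.< j → Final i (legˡ j)
    at-legʳ : ∀ {j} → j ℕ.< i → Final i (legʳ j)
    at-arm  : ∀ {m} → Final i (arm i m)

  -- Near i r g: going from arm i (suc n) to g, the links of a path in ⋃ can
  -- have used up all but r of the n + 2 available ones.
  Near : ℕ → ℕ → Tag → Set
  Near i zero    g = Final i g
  Near i (suc r) g = ∃[ m ] (g ≡ arm i m × r ≤ℕ m)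

  near⇒final : ∀ i r g → Near i r g → Final i g
  near⇒final i zero    g f              = f
  near⇒final i (suc r) _ (_ , refl , _) = at-arm

  -- Whatever meets segment `m` of the arm is a segment of the same arm with index at least `m - 1`,
  -- or a leg; legs meet only segment 0, where `r ≤ m` leaves `r = 0`.
  near-step : ∀ i r g h z → Valid g → OnTag g z → OnTag h z → Near i (suc r) h → Near i r g
  near-step i r g .(arm i m) z v o o′ (m , refl , r≤m) = cases r r≤m (adjacent i m g z v o o′)
    where
    cases : ∀ r {g} → r ≤ℕ m → Adjacent i m g → Near i r g
    cases zero    _   (to-legˡ _ i<j) = at-legˡ i<j
    cases zero    _   (to-legʳ _ j<i) = at-legʳ j<i
    cases zero    _   (to-arm _)      = at-arm
    cases (suc r) ()  (to-legˡ refl _)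
    cases (suc r) ()  (to-legʳ refl _)
    cases (suc r) r<m (to-arm m≤)     = _ , refl , ℕ.s≤s⁻¹ (ℕ.≤-trans r<m m≤)

  -- The path is traced back from `y`. By `common-segment` each link has both ends on one segment,
  -- which meets the segment found for the rest of the path, so each of the `suc l` links costs one
  -- unit.
  near-path : ∀ {l} (vs : Vec ℝ² l) i r x y h → polygonalPath x vs y ⊆ ⋃ → OnTag h y →
              Near i (suc l ℕ.+ r) h → ¬ ¬ (∃[ g ] (Valid g × OnTag g x × Near i r g))
  near-path [] i r x y h path⊆⋃ oy near none =
    common-segment x y (λ {z} → path⊆⋃ {z}) λ (g , v , ox , oy′) →
    none (g , v , ox , near-step i r g h y v oy′ oy near)
  near-path {suc l} (w ∷ vs) i r x y h path⊆⋃ oy near none =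
    near-path vs i (suc r) w y h (λ {z} z∈ → path⊆⋃ {z} (inj₂ z∈)) oy
      (subst (λ s → Near i s h) (cong suc (sym (ℕ.+-suc l r))) near) λ (g′ , _ , ow , near′) →
    common-segment x w (λ {z} z∈ → path⊆⋃ {z} (inj₁ z∈)) λ (g , v , ox , ow′) →
    none (g , v , ox , near-step i r g g′ w v ow′ ow near′)

  visible⇒final : ∀ i x → VisibleWithin (suc (suc n)) ⋃ x (corner i n) →
                  ¬ ¬ (∃[ g ] (Valid g × OnTag g x × Final i g))
  visible⇒final i x (suc l , _ , l<n+2 , vs , _ , path⊆⋃) none =
    near-path vs i r x (corner i n) (arm i (suc n)) (λ {z} → path⊆⋃ {z}) (corner-on-next-arm i n)
      (subst (λ s → Near i s (arm i (suc n))) (sym (ℕ.m+[n∸m]≡n l<n+2)) (suc n , refl , ℕ.≤-refl))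
      λ (g , v , o , near) → none (g , v , o , near⇒final i r g near)
    where
    r = suc (suc n) ℕ.∸ suc l

  -- The lines meet where `2x = 3l - j`, and `l ≤ x ≤ j` then gives both `j ≤ l` and `l ≤ j`.
  legs-meet : ∀ j l z → OnTag (legˡ j) z → OnTag (legʳ l) z → j ≡ l
  legs-meet j l z o o′ = ℕ.≤-antisym
    (bound j l (solve 2 (λ J L → ((((L :+ (L :+ (L :+ con 0ℤ))) :- J) :+ :- L) :+ :- L) := L :- J) refl (+ j) (+ l))
      (halfPlane-+ (halfPlane-+ (crossing (line o′) (line o)) (right-of o′)) (right-of o′)))
    (ℕ.*-cancelˡ-≤ 3 (bound (3 ℕ.* l) (3 ℕ.* j)
      (solve 2 (λ J L → ((J :- L) :+ J) :+ J := (J :+ (J :+ (J :+ con 0ℤ))) :- L) refl (+ j) (+ (3 ℕ.* l)))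
      (halfPlane-+ (halfPlane-+ (crossing (line o) (line o′)) (left-of o)) (left-of o))))
    where
    bound : ∀ a b {c} → c ≡ + b ℤ.- + a → HalfPlane 0ℤ 0ℤ c z → a ≤ℕ b
    bound a b refl h = ℤ.drop‿+≤+ (ℤ.0≤i-j⇒j≤i (halfPlane-const⁻¹ {z = z} h))

  -- Index 0 allows only left legs and arm 0, index `k` only right legs and arm `k`. Incidence
  -- leaves a left and a right leg, which must have the same index.
  no-final-point : ∀ x → 1 ≤ℕ k → ¬ (∀ i → i ≤ℕ k → ¬ ¬ (∃[ g ] (Valid g × OnTag g x × Final i g)))
  no-final-point x k≥1 final =
    final 0 ℕ.z≤n λ (g , v , o , f) →
    final k ℕ.≤-refl λ (h , w , o′ , f′) →
    ends g h v w o o′ f f′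
    where
    arms-disjoint : ∀ m m′ → OnTag (arm 0 m) x → ¬ OnTag (arm k m′) x
    arms-disjoint m m′ o o′ = ℕ.<⇒≢ k≥1 (proj₁ (arms-meet 0 k m m′ x o o′))

    at-vertex : ∀ j → OnTag (legˡ j) x → OnTag (legʳ j) x → ∀ g → OnTag g x → ¬ Final j g
    at-vertex j oˡ oʳ (legˡ _)  o (at-legˡ j<l) =
      ℕ.<⇒≢ j<l (ℤ.+-injective (parallel {z = x} (line oˡ) (line o)))
    at-vertex j oˡ oʳ (legʳ l)  o (at-legʳ l<j) =
      ℕ.<⇒≢ l<j (ℕ.*-cancelˡ-≡ l j 3 (ℤ.+-injective (parallel {z = x} (line o) (line oʳ))))
    at-vertex j oˡ oʳ (arm _ m) o at-arm =
      ℕ.<-irrefl refl (proj₂ (legʳ-meets-arm j m j x oʳ o))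

    ends : ∀ g h → Valid g → Valid h → OnTag g x → OnTag h x → Final 0 g → Final k h → ⊥
    ends g        (legˡ j)  _ w _ _  _       (at-legˡ k<j) = ℕ.<⇒≱ k<j w
    ends (arm _ m) (legʳ j) _ w o o′ at-arm  (at-legʳ j<k) with () ← proj₂ (legʳ-meets-arm 0 m j x o′ o)
    ends (arm _ m) (arm _ m′) _ w o o′ at-arm at-arm       = arms-disjoint m m′ o o′
    ends (legˡ j) (arm _ m) v w o o′ (at-legˡ 0<j) at-arm  =
      ℕ.<⇒≱ (proj₂ (legˡ-meets-arm k m j x v o o′)) v
    ends (legˡ j) (legʳ l)  v w o o′ (at-legˡ 0<j) (at-legʳ l<k) =
      -- Here `x` lies on both legs of the same vertex, so the hypothesis is applied a third time,
      -- at index `j`, where neither a parallel leg nor arm `j` passes through `x`.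
      final j v λ (g , _ , og , f) →
      at-vertex j o (subst (λ l → OnTag (legʳ l) x) (sym (legs-meet j l x o o′)) o′) g og f

  no-common-viewpoint : 1 ≤ℕ k → ¬ HasCommonViewpoint (suc (suc n)) ⋃ (λ (i : Fin (suc k)) → corner (toℕ i) n)
  no-common-viewpoint k≥1 (c , _ , visible) = no-final-point c k≥1 λ i i≤k →
    visible⇒final i c (subst (λ i → VisibleWithin (suc (suc n)) ⋃ c (corner i n))
      (Fin.toℕ-fromℕ< (ℕ.s≤s i≤k)) (visible (fromℕ< (ℕ.s≤s i≤k))))

theorem1p6 : (n k : ℕ) → 2 ≤ℕ n → 2 ≤ℕ k →
    Σ[ S ∈ Pred ℝ² 0ℓ ]
    ( S Respects _≈²_
    × ((p : Fin k → ℝ²) → (∀ i → p i ∈ S) → HasCommonViewpoint n S p)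
    × Σ[ q ∈ (Fin (suc k) → ℝ²) ]
    ( Injective _≡_ _≈²_ q
    × (∀ i → q i ∈ S)
    × ¬ HasCommonViewpoint n S q))
-- After matching, `n` is the given length minus 2; the arms have segments 0 to `n`, and their far
-- ends are the `k + 1` points.
theorem1p6 (suc (suc n)) k (ℕ.s≤s (ℕ.s≤s _)) k≥2 =
  ⋃ , (λ {x} {y} → ⋃-resp {x} {y}) , common-viewpoint ,
  (λ i → corner (toℕ i) n) ,
  (λ {i} {j} eq → Fin.toℕ-injective (corner-injective (toℕ i) (toℕ j) n eq)) ,
  (λ i → arm (toℕ i) n , (ℕ.s≤s⁻¹ (Fin.toℕ<n i) , ℕ.≤-refl) , corner-on-arm (toℕ i) n) ,
  no-common-viewpoint (ℕ.<⇒≤ k≥2)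
  where
  open Construction k n
  open Union Valid seg seg-injective ¬¬-bound
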